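{- For every fixed integer $d\ge 3$, a random graph $G\in\mathcal{G}_{n,d}$ is asymptotically almost surely normal; that is, the probability that $G$ is normal tends to $1$ as $n\to\infty$ (over $n$ with $dn$ even).
   Context: $\mathcal{G}_{n,d}$ denotes the uniform probability space of all simple $d$-regular graphs on the vertex set $\{1,\dots,n\}$, where $dn$ is even. A graph $G$ is normal if there exist a set $\mathcal C$ of cliques of $G$ and a set $\mathcal I$ of stable (independent) sets of $G$ such that (1) every vertex of $G$ lies in some clique of $\mathcal C$; (2) every vertex of $G$ lies in some stable set of $\mathcal I$; (3) every clique in $\mathcal C$ and every stable set in $\mathcal I$ have a vertex in common. -}

module Defs where

open import Data.Nat using (ℕ; zero; suc; _*_; _≤_)
open import Data.Nat.Divisibility using (_∣_)
open import Data.Fin using (Fin)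
open import Data.Vec using (Vec; lookup)
open import Data.Fin.Subset using (Subset; _∈_; _∉_; ∣_∣)
open import Data.List using (List; length)
open import Data.List.Relation.Unary.All using (All)
open import Data.List.Relation.Unary.Unique.Propositional using (Unique)
import Data.List.Membership.Propositional as LM
open import Data.Product using (Σ; ∃; _×_)
open import Relation.Binary.PropositionalEquality using (_≡_; _≢_)
open import Relation.Nullary using (¬_)

-- A graph on vertex set Fin n, given by its rows of the adjacency matrix:
-- row i is the neighbourhood of vertex i, as a subset of Fin n.
AdjMat : ℕ → Set
AdjMat n = Vec (Subset n) n

module _ {n : ℕ} (G : AdjMat n) where

  Adj : Fin n → Fin n → Set
  Adj i j = j ∈ lookup G i

  IsSimple : Set
  IsSimple = (∀ i → ¬ Adj i i) × (∀ i j → Adj i j → Adj j i)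

  IsRegular : ℕ → Set
  IsRegular d = ∀ i → ∣ lookup G i ∣ ≡ d

  IsClique : Subset n → Set
  IsClique S = ∀ i j → i ∈ S → j ∈ S → i ≢ j → Adj i j

  IsStable : Subset n → Set
  IsStable S = ∀ i j → i ∈ S → j ∈ S → ¬ Adj i j

  IsNormal : Set
  IsNormal = Σ (List (Subset n)) λ C → Σ (List (Subset n)) λ I →
      All IsClique C × All IsStable I
    × (∀ v → ∃ λ K → K LM.∈ C × v ∈ K)
    × (∀ v → ∃ λ S → S LM.∈ I × v ∈ S)
    × All (λ K → All (λ S → ∃ λ v → v ∈ K × v ∈ S) I) C

Enumerates : (n d : ℕ) → List (AdjMat n) → Set
Enumerates n d L =
    Unique L
  × All (λ G → IsSimple G × IsRegular G d) L
  × (∀ G → IsSimple G → IsRegular G d → G LM.∈ L)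

-- P(normal) ≥ 1 - 1/(k+1) in G_{n,d}, enumerated by L: there is a set M of
-- distinct normal graphs of the space with (k+1)|M| ≥ k |L|.
NormalProbAtLeast : (n : ℕ) → List (AdjMat n) → ℕ → Set
NormalProbAtLeast n L k = Σ (List (AdjMat n)) λ M →
    Unique M × All (λ G → G LM.∈ L) M × All IsNormal M
  × k * length L ≤ suc k * length M

{-# OPTIONS --safe #-}
module Submission where

-- Call a vertex set a tangle if it induces minimum degree at least 2 and some degree at least 3.
-- A tangle on s vertices spans at least s + 1 edges. Switching uv, xy to ux, vy shows that s + 1
-- prescribed edges are present with probability O(n ^ -(s + 1)), so a union bound over the
-- O(n ^ s) possible positions excludes all tangles of bounded size with probability 1 - O(1/n).
--
-- A d-regular graph without small tangles is normal. Let U be the union of the small vertex sets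
-- inducing minimum degree at least 2 (the short cycles). By tangle-freeness the neighbours of U
-- outside U form a stable set and every vertex of U has one, so a maximal stable set Z containing
-- them misses U. Colour the vertices so that vertices joined by a walk of length 4 differ. As
-- cliques take the edges joining v outside Z to its neighbour in Z of highest colour (its centre),
-- and z in Z to the neighbour whose centre has lowest colour. Z itself meets all of them. Forcing a
-- vertex outside Z into the stable set propagates to further vertices outside Z, but each change
-- of centre lowers the colour, so everything forced lies within bounded distance; an edge between
-- two forced vertices would close a short odd cycle through Z, contradicting that Z misses U.

open import Defs
open import Data.Bool using (true; false; _xor_)
import Data.Bool.Properties as Bool
open import Data.Empty using (⊥-elim)
open import Data.Fin using (Fin; zero; suc)
import Data.Fin.Properties as Fin
open import Data.Fin.Subset using (Subset; _∈_; _∉_; _⊆_; ∣_∣; ⁅_⁆; _∪_; ⊥)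
open import Data.Fin.Subset.Properties using (_∈?_; x∈⁅x⁆; x∈⁅y⁆⇒x≡y; p⊆p∪q; q⊆p∪q; x∈p∪q⁻; x∈p∪q⁺;
  p⊆q⇒∣p∣≤∣q∣; p⊂q⇒∣p∣<∣q∣; ∣p∣≤n; ∉⊥; anySubset?)
open import Data.List using (List; []; _∷_; _++_; length; map; concatMap; upTo; allFin; filter; foldr;
  take; cartesianProduct; cartesianProductWith)
open import Data.List.Properties using (length-map; length-++; length-upTo; length-tabulate; length-take;
  length-filter; filter-none; filter-all)
open import Data.List.Membership.Propositional using (find; lose) renaming (_∈_ to _∈ˡ_; _∉_ to _∉ˡ_)
open import Data.List.Membership.Propositional.Properties
open import Data.List.Relation.Unary.All as All using (All; []; _∷_)
import Data.List.Relation.Unary.All.Properties as All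
open import Data.List.Relation.Unary.AllPairs as AllPairs using (AllPairs; []; _∷_)
import Data.List.Relation.Unary.AllPairs.Properties as AllPairs
open import Data.List.Relation.Unary.Any as Any using (Any; here; there)
open import Data.List.Relation.Unary.Unique.Propositional using (Unique)
import Data.List.Relation.Unary.Unique.Propositional.Properties as Uniq
open import Data.Nat
open import Data.Nat.Divisibility using (_∣_)
open import Data.Nat.ListAction using (sum)
open import Data.Nat.Properties
open import Data.Nat.Tactic.RingSolver using (solve-∀)
open import Data.Product using (∃; _×_; _,_; proj₁; proj₂)
open import Data.Sum using (_⊎_; inj₁; inj₂; [_,_])
open import Data.Unit using (tt)
import Data.Vec as Vec
open import Data.Vec using (here; there; lookup; tabulate)
import Data.Vec.Properties as Vec
open import Function using (_∘_; id)
open import Relation.Binary.PropositionalEquality hiding ([_])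
open import Relation.Nullary
open import Relation.Unary using (Decidable)
open import Relation.Unary.Properties using (U?; ∅?)

-- Finite lists and colourings

length-mono-⊆ : {A : Set} {xs ys : List A} → Unique xs → (∀ {x} → x ∈ˡ xs → x ∈ˡ ys) →
  length xs ≤ length ys
length-mono-⊆ {xs = []} _ _ = z≤n
length-mono-⊆ {xs = x ∷ xs} (x∉ ∷ u) sub with ∈-∃++ (sub (here refl))
... | as , bs , refl = begin
  suc (length xs)             ≤⟨ s≤s (length-mono-⊆ u sub′) ⟩
  suc (length (as ++ bs))     ≡⟨ cong suc (length-++ as) ⟩
  suc (length as + length bs) ≡⟨ sym (+-suc (length as) (length bs)) ⟩
  length as + suc (length bs) ≡⟨ sym (length-++ as) ⟩
  length (as ++ x ∷ bs)       ∎
  where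
  open ≤-Reasoning
  sub′ : ∀ {y} → y ∈ˡ xs → y ∈ˡ as ++ bs
  sub′ y∈ with ∈-++⁻ as (sub (there y∈))
  ... | inj₁ q = ∈-++⁺ˡ q
  ... | inj₂ (here refl) = ⊥-elim (All.lookup x∉ y∈ refl)
  ... | inj₂ (there q) = ∈-++⁺ʳ as q

length-concatMap≤ : {A B : Set} (f : A → List B) {c : ℕ} → ∀ xs → (∀ {x} → x ∈ˡ xs → length (f x) ≤ c) →
  length (concatMap f xs) ≤ length xs * c
length-concatMap≤ f [] b = z≤n
length-concatMap≤ f (x ∷ xs) b = ≤-trans (≤-reflexive (length-++ (f x)))
  (+-mono-≤ (b (here refl)) (length-concatMap≤ f xs (b ∘ there)))

length-cartesianProductWith : {A B C : Set} (f : A → B → C) (xs : List A) (ys : List B) →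
  length (cartesianProductWith f xs ys) ≡ length xs * length ys
length-cartesianProductWith f [] ys = refl
length-cartesianProductWith f (x ∷ xs) ys = trans (length-++ (map (f x) ys))
  (cong₂ _+_ (length-map (f x) ys) (length-cartesianProductWith f xs ys))

∈-concatMap : {A B : Set} {f : A → List B} {xs : List A} {x : A} {y : B} →
  x ∈ˡ xs → y ∈ˡ f x → y ∈ˡ concatMap f xs
∈-concatMap {f = f} {y = y} x∈ y∈ = ∈-concatMap⁺ f (Any.map (λ e → subst (λ a → y ∈ˡ f a) e y∈) x∈)

-- Pigeonhole: the candidates 0 to `length xs` cannot all occur among `length xs` entries.
fresh : (xs : List ℕ) → ∃ λ c → c ≤ length xs × c ∉ˡ xs
fresh xs with Any.any? (λ c → ¬? (Any.any? (c ≟_) xs)) (upTo (suc (length xs)))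
... | yes p = let c , c∈ , c∉ = find p in c , s≤s⁻¹ (∈-upTo⁻ c∈) , c∉
... | no ¬p = ⊥-elim (<-irrefl refl (begin-strict
    length xs                        <⟨ n<1+n _ ⟩
    suc (length xs)                  ≡⟨ sym (length-upTo (suc (length xs))) ⟩
    length (upTo (suc (length xs)))  ≤⟨ length-mono-⊆ (Uniq.upTo⁺ _)
       (λ x∈ → decidable-stable (Any.any? (_ ≟_) xs) (All.lookup (All.¬Any⇒All¬ _ ¬p) x∈)) ⟩
    length xs                        ∎))
  where open ≤-Reasoning

argmin : {A : Set} {P : A → Set} (μ : A → ℕ) → (∀ m → Dec (∃ λ y → P y × μ y < m)) → ∃ P →
  ∃ λ x → P x × (∀ y → P y → μ x ≤ μ y)
argmin {P = P} μ P<? (x , px) = go (suc (μ x)) x px ≤-refl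
  where
  go : ∀ m x → P x → μ x < m → ∃ λ x → P x × (∀ y → P y → μ x ≤ μ y)
  go (suc m) x px lt with P<? (μ x)
  ... | yes (y , py , lt′) = go m y py (<-≤-trans lt′ (s≤s⁻¹ lt))
  ... | no ¬q = x , px , λ y py → ≮⇒≥ (λ l → ¬q (y , py , l))

-- Vertices are coloured one at a time, each with a colour absent from its list; symmetry of `near`
-- covers pairs met in the other order. Equal colours yield `x ≡ y` rather than a contradiction
-- because `near x` may contain `x`, as a closed walk returns to its start.
greedyColouring : ∀ {n} (near : Fin n → List (Fin n)) (c : ℕ) → (∀ x → length (near x) ≤ c) →
  (∀ {x y} → y ∈ˡ near x → x ∈ˡ near y) →
  ∃ λ (col : Fin n → ℕ) → (∀ x → col x ≤ c) × (∀ x y → y ∈ˡ near x → col x ≡ col y → x ≡ y)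
greedyColouring {n} near c len symm =
  let col , b , p = go (allFin n) in col , b , λ x y → p x y (∈-allFin x) (∈-allFin y)
  where
  go : ∀ xs → ∃ λ (col : Fin n → ℕ) → (∀ x → col x ≤ c) ×
    (∀ x y → x ∈ˡ xs → y ∈ˡ xs → y ∈ˡ near x → col x ≡ col y → x ≡ y)
  -- Vertices not yet reached carry the placeholder colour 0; properness is claimed only on the
  -- listed ones.
  go [] = (λ _ → 0) , (λ _ → z≤n) , λ _ _ ()
  go (x ∷ xs) = col′ , bound , proper
    where
    col = proj₁ (go xs)
    k = proj₁ (fresh (map col (near x)))
    k≤ : k ≤ c
    k≤ = ≤-trans (proj₁ (proj₂ (fresh (map col (near x)))))
           (≤-trans (≤-reflexive (length-map col (near x))) (len x))
    k∉ : ∀ {y} → y ∈ˡ near x → k ≢ col y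
    k∉ y∈ e = proj₂ (proj₂ (fresh (map col (near x)))) (subst (_∈ˡ _) (sym e) (∈-map⁺ col y∈))
    col′ : Fin n → ℕ
    col′ y with y Fin.≟ x
    ... | yes _ = k
    ... | no  _ = col y
    bound : ∀ y → col′ y ≤ c
    bound y with y Fin.≟ x
    ... | yes _ = k≤
    ... | no  _ = proj₁ (proj₂ (go xs)) y
    back : ∀ {y} → y ∈ˡ x ∷ xs → y ≢ x → y ∈ˡ xs
    back (here e) ne = ⊥-elim (ne e)
    back (there p) _ = p
    proper : ∀ y z → y ∈ˡ x ∷ xs → z ∈ˡ x ∷ xs → z ∈ˡ near y → col′ y ≡ col′ z → y ≡ z
    proper y z y∈ z∈ nr e with y Fin.≟ x | z Fin.≟ x
    ... | yes p    | yes q    = trans p (sym q)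
    ... | yes refl | no _     = ⊥-elim (k∉ nr e)
    ... | no _     | yes refl = ⊥-elim (k∉ (symm nr) (sym e))
    ... | no p     | no q     = proj₂ (proj₂ (go xs)) y z (back y∈ p) (back z∈ q) nr e

-- Subsets of Fin n

module _ {n : ℕ} where

  toSubset : List (Fin n) → Subset n
  toSubset = foldr (λ x p → ⁅ x ⁆ ∪ p) ⊥

  ∈-toSubset⁺ : ∀ {x xs} → x ∈ˡ xs → x ∈ toSubset xs
  ∈-toSubset⁺ {xs = y ∷ xs} (here refl) = x∈p∪q⁺ (inj₁ (x∈⁅x⁆ y))
  ∈-toSubset⁺ {xs = y ∷ xs} (there p) = x∈p∪q⁺ (inj₂ (∈-toSubset⁺ p))

  ∈-toSubset⁻ : ∀ {x} xs → x ∈ toSubset xs → x ∈ˡ xs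
  ∈-toSubset⁻ [] p = ⊥-elim (∉⊥ p)
  ∈-toSubset⁻ (y ∷ xs) p with x∈p∪q⁻ ⁅ y ⁆ _ p
  ... | inj₁ q = here (x∈⁅y⁆⇒x≡y y q)
  ... | inj₂ q = there (∈-toSubset⁻ xs q)

  comprehension : {P : Fin n → Set} → Decidable P →
    ∃ λ p → (∀ {x} → P x → x ∈ p) × (∀ {x} → x ∈ p → P x)
  comprehension P? = toSubset (filter P? (allFin n)) ,
    (λ px → ∈-toSubset⁺ (∈-filter⁺ P? (∈-allFin _) px)) ,
    (λ x∈ → proj₂ (∈-filter⁻ P? {xs = allFin n} (∈-toSubset⁻ _ x∈)))

elems : ∀ {n} → Subset n → List (Fin n)
elems Vec.[] = []
elems (true Vec.∷ p) = zero ∷ map suc (elems p)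
elems (false Vec.∷ p) = map suc (elems p)

length-elems : ∀ {n} (p : Subset n) → length (elems p) ≡ ∣ p ∣
length-elems Vec.[] = refl
length-elems (true Vec.∷ p) = cong suc (trans (length-map suc (elems p)) (length-elems p))
length-elems (false Vec.∷ p) = trans (length-map suc (elems p)) (length-elems p)

∈-elems⁺ : ∀ {n x} {p : Subset n} → x ∈ p → x ∈ˡ elems p
∈-elems⁺ {p = true Vec.∷ p} here = here refl
∈-elems⁺ {p = true Vec.∷ p} (there x∈) = there (∈-map⁺ suc (∈-elems⁺ x∈))
∈-elems⁺ {p = false Vec.∷ p} (there x∈) = ∈-map⁺ suc (∈-elems⁺ x∈)

∈-elems⁻ : ∀ {n x} (p : Subset n) → x ∈ˡ elems p → x ∈ p
∈-elems⁻ (true Vec.∷ p) (here refl) = here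
∈-elems⁻ (true Vec.∷ p) (there x∈) with ∈-map⁻ suc x∈
... | y , y∈ , refl = there (∈-elems⁻ p y∈)
∈-elems⁻ (false Vec.∷ p) x∈ with ∈-map⁻ suc x∈
... | y , y∈ , refl = there (∈-elems⁻ p y∈)

elems-unique : ∀ {n} (p : Subset n) → Unique (elems p)
elems-unique Vec.[] = []
elems-unique (true Vec.∷ p) =
  All.tabulate (λ x∈ e → contradiction (proj₂ (proj₂ (∈-map⁻ suc x∈))) (λ e′ → Fin.0≢1+n (trans e e′)))
  ∷ Uniq.map⁺ Fin.suc-injective (elems-unique p)
elems-unique (false Vec.∷ p) = Uniq.map⁺ Fin.suc-injective (elems-unique p)

∣∣≤length : ∀ {n} (p : Subset n) (xs : List (Fin n)) → (∀ {x} → x ∈ p → x ∈ˡ xs) → ∣ p ∣ ≤ length xs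
∣∣≤length p xs sub = ≤-trans (≤-reflexive (sym (length-elems p)))
  (length-mono-⊆ (elems-unique p) (sub ∘ ∈-elems⁻ p))

∣p∪q∣≤∣p∣+∣q∣ : ∀ {n} (p q : Subset n) → ∣ p ∪ q ∣ ≤ ∣ p ∣ + ∣ q ∣
∣p∪q∣≤∣p∣+∣q∣ p q = begin
  ∣ p ∪ q ∣                             ≤⟨ ∣∣≤length (p ∪ q) (elems p ++ elems q) split ⟩
  length (elems p ++ elems q)           ≡⟨ length-++ (elems p) ⟩
  length (elems p) + length (elems q)   ≡⟨ cong₂ _+_ (length-elems p) (length-elems q) ⟩
  ∣ p ∣ + ∣ q ∣                         ∎
  where
  open ≤-Reasoning
  split : ∀ {x} → x ∈ p ∪ q → x ∈ˡ elems p ++ elems q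
  split x∈ with x∈p∪q⁻ p q x∈
  ... | inj₁ x∈p = ∈-++⁺ˡ (∈-elems⁺ x∈p)
  ... | inj₂ x∈q = ∈-++⁺ʳ (elems p) (∈-elems⁺ x∈q)

-- Growth by one vertex at a time must end, since no subset has more than `n` elements. Serves both
-- for maximal stable sets and for closure under forcing.
saturate : ∀ {n} (P Stop : Subset n → Set) →
  (∀ q → P q → Stop q ⊎ ∃ λ x → x ∉ q × P (⁅ x ⁆ ∪ q)) →
  ∀ q → P q → ∃ λ r → q ⊆ r × P r × Stop r
saturate {n} P Stop step q pq = go (suc n) q pq (s≤s (m≤m+n n ∣ q ∣))
  where
  go : ∀ m q → P q → n < m + ∣ q ∣ → ∃ λ r → q ⊆ r × P r × Stop r
  go zero q pq lt = ⊥-elim (<-irrefl refl (<-≤-trans lt (∣p∣≤n q)))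
  go (suc m) q pq lt with step q pq
  ... | inj₁ s = q , id , pq , s
  ... | inj₂ (x , x∉ , px) =
    let r , sub , pr , s = go m (⁅ x ⁆ ∪ q) px (≤-trans lt (≤-trans (≤-reflexive (sym (+-suc m ∣ q ∣)))
                             (+-monoʳ-≤ m (p⊂q⇒∣p∣<∣q∣ (q⊆p∪q ⁅ x ⁆ q , x , x∈p∪q⁺ (inj₁ (x∈⁅x⁆ x)) , x∉)))))
    in r , sub ∘ q⊆p∪q ⁅ x ⁆ q , pr , s

-- Walks and paths

module _ {n : ℕ} where

  data Walk (E : Fin n → Fin n → Set) : ℕ → Fin n → Fin n → Set where
    []  : ∀ {a} → Walk E 0 a a
    _∷_ : ∀ {a b c m} → E a b → Walk E m b c → Walk E (suc m) a c

  data Path (E : Fin n → Fin n → Set) : Fin n → Fin n → List (Fin n) → Set where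
    stop : ∀ a → Path E a a (a ∷ [])
    cons : ∀ {a b c l} → E a b → a ∉ˡ l → Path E b c l → Path E a c (a ∷ l)

  module _ {E : Fin n → Fin n → Set} where

    infixr 5 _++ʷ_
    _++ʷ_ : ∀ {a b c k m} → Walk E k a b → Walk E m b c → Walk E (k + m) a c
    [] ++ʷ w = w
    (e ∷ v) ++ʷ w = e ∷ (v ++ʷ w)

    reverseʷ : (∀ {a b} → E a b → E b a) → ∀ {a b m} → Walk E m a b → Walk E m b a
    reverseʷ s [] = []
    reverseʷ s {a} {b} {suc m} (e ∷ w) = subst (λ k → Walk E k b a) (+-comm m 1) (reverseʷ s w ++ʷ (s e ∷ []))

    head∈ : ∀ {a c l} → Path E a c l → a ∈ˡ l
    head∈ (stop a) = here refl
    head∈ (cons _ _ _) = here refl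

    last∈ : ∀ {a c l} → Path E a c l → c ∈ˡ l
    last∈ (stop a) = here refl
    last∈ (cons _ _ p) = there (last∈ p)

    suffix : ∀ {a b c l} → Path E b c l → a ∈ˡ l → ∃ λ l′ → Path E a c l′ × length l′ ≤ length l
    suffix (stop b) (here refl) = _ , stop b , ≤-refl
    suffix (cons e x p) (here refl) = _ , cons e x p , ≤-refl
    suffix (cons e x p) (there a∈) = let l′ , p′ , le = suffix p a∈ in l′ , p′ , m≤n⇒m≤1+n le

    -- When the first vertex already lies on the path built from the rest, only the part of that
    -- path from this vertex on is kept.
    loopErase : ∀ {a c m} → Walk E m a c → ∃ λ l → Path E a c l × length l ≤ suc m
    loopErase [] = _ , stop _ , ≤-refl
    loopErase {a} (e ∷ w) with loopErase w
    ... | l , p , le with Any.any? (a Fin.≟_) l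
    ... | yes a∈ = let l′ , p′ , le′ = suffix p a∈ in l′ , p′ , ≤-trans le′ (m≤n⇒m≤1+n le)
    ... | no a∉ = _ , cons e a∉ p , s≤s le

    -- The cases are the trivial path, the two ends and the interior. Predecessor and successor of
    -- an interior vertex differ because the predecessor does not recur later. An additional edge
    -- between the ends then completes minimum degree 2.
    pathDegrees : (∀ {a b} → E a b → E b a) → ∀ {a c l u} → Path E a c l → u ∈ˡ l →
        (u ≡ a × u ≡ c)
      ⊎ (u ≡ a × ∃ λ w → w ∈ˡ l × E u w)
      ⊎ (u ≡ c × ∃ λ w → w ∈ˡ l × E u w)
      ⊎ (∃ λ v → ∃ λ w → v ≢ w × (v ∈ˡ l × E u v) × (w ∈ˡ l × E u w))
    pathDegrees s (stop a) (here refl) = inj₁ (refl , refl)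
    pathDegrees s (cons e x p) (here refl) = inj₂ (inj₁ (refl , _ , there (head∈ p) , e))
    pathDegrees s {a} (cons e x p) (there u∈) with pathDegrees s p u∈
    ... | inj₁ (refl , eq) = inj₂ (inj₂ (inj₁ (eq , a , here refl , s e)))
    ... | inj₂ (inj₁ (refl , w , w∈ , f)) =
          inj₂ (inj₂ (inj₂ (a , w , (λ { refl → x w∈ }) , (here refl , s e) , (there w∈ , f))))
    ... | inj₂ (inj₂ (inj₁ (eq , w , w∈ , f))) = inj₂ (inj₂ (inj₁ (eq , w , there w∈ , f)))
    ... | inj₂ (inj₂ (inj₂ (v , w , ne , (v∈ , f) , (w∈ , g)))) =
          inj₂ (inj₂ (inj₂ (v , w , ne , (there v∈ , f) , (there w∈ , g))))

-- Normality from a maximal stable set avoiding short cycles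

module _ {n : ℕ} (G : AdjMat n) where

  TwoNeighboursIn : Subset n → Fin n → Set
  TwoNeighboursIn p u = ∃ λ a → ∃ λ b → a ≢ b × (a ∈ p × Adj G u a) × (b ∈ p × Adj G u b)

  ThreeNeighboursIn : Subset n → Fin n → Set
  ThreeNeighboursIn p u = ∃ λ a → ∃ λ b → ∃ λ c → (a ≢ b × a ≢ c × b ≢ c) ×
    (a ∈ p × Adj G u a) × (b ∈ p × Adj G u b) × (c ∈ p × Adj G u c)

  MinDegree2 : Subset n → Set
  MinDegree2 p = ∀ u → u ∈ p → TwoNeighboursIn p u

  Tangle : Subset n → Set
  Tangle p = MinDegree2 p × ∃ λ u → u ∈ p × ThreeNeighboursIn p u

  -- Sets of minimum degree at least 2 stand in for short cycles: the vertex set of a cycle is one,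
  -- and unions of such sets are again such sets.
  InShortCore : ℕ → Fin n → Set
  InShortCore g v = ∃ λ p → ∣ p ∣ ≤ g × v ∈ p × MinDegree2 p

  adj? : ∀ u v → Dec (Adj G u v)
  adj? u v = v ∈? lookup G u

  inShortCore? : ∀ g → Decidable (InShortCore g)
  inShortCore? g v = anySubset? λ p → (∣ p ∣ ≤? g) ×-dec (v ∈? p) ×-dec Fin.all? λ u →
    (u ∈? p) →-dec Fin.any? λ a → Fin.any? λ b →
      ¬? (a Fin.≟ b) ×-dec ((a ∈? p) ×-dec adj? u a) ×-dec ((b ∈? p) ×-dec adj? u b)

  twoMono : ∀ {p q u} → p ⊆ q → TwoNeighboursIn p u → TwoNeighboursIn q u
  twoMono sub (a , b , ne , (a∈ , ua) , (b∈ , ub)) = a , b , ne , (sub a∈ , ua) , (sub b∈ , ub)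

  minDegree2-∪ : ∀ {p q} → MinDegree2 p → MinDegree2 q → MinDegree2 (p ∪ q)
  minDegree2-∪ {p} {q} mp mq u u∈ with x∈p∪q⁻ p q u∈
  ... | inj₁ i = twoMono (p⊆p∪q q) (mp u i)
  ... | inj₂ i = twoMono (q⊆p∪q p q) (mq u i)

  record MaximalStable (Z : Subset n) : Set where
    field
      isStable   : IsStable G Z
      dominating : ∀ v → v ∉ Z → ∃ λ z → z ∈ Z × Adj G v z

  extendStable : IsSimple G → ∀ W → IsStable G W → ∃ λ Z → W ⊆ Z × MaximalStable Z
  extendStable (irrefl , symm) W st =
    let Z , sub , stZ , dom = saturate (IsStable G) (λ q → ∀ v → v ∉ q → ∃ λ z → z ∈ q × Adj G v z) step W st
    in Z , sub , record { isStable = stZ ; dominating = dom }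
    where
    step : ∀ q → IsStable G q → (∀ v → v ∉ q → ∃ λ z → z ∈ q × Adj G v z) ⊎
      ∃ λ x → x ∉ q × IsStable G (⁅ x ⁆ ∪ q)
    step q st with Fin.any? (λ v → ¬? (v ∈? q) ×-dec ¬? (Fin.any? λ z → (z ∈? q) ×-dec adj? v z))
    ... | no none = inj₁ λ v v∉ → decidable-stable (Fin.any? λ z → (z ∈? q) ×-dec adj? v z)
                      (λ ¬e → none (v , v∉ , ¬e))
    ... | yes (x , x∉ , free) = inj₂ (x , x∉ , st′)
      where
      st′ : IsStable G (⁅ x ⁆ ∪ q)
      st′ i j i∈ j∈ a with x∈p∪q⁻ ⁅ x ⁆ q i∈ | x∈p∪q⁻ ⁅ x ⁆ q j∈
      ... | inj₂ i∈q | inj₂ j∈q = st i j i∈q j∈q a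
      ... | inj₁ i≡  | inj₂ j∈q rewrite x∈⁅y⁆⇒x≡y x i≡ = free (j , j∈q , a)
      ... | inj₂ i∈q | inj₁ j≡  rewrite x∈⁅y⁆⇒x≡y x j≡ = free (i , i∈q , symm i x a)
      ... | inj₁ i≡  | inj₁ j≡  rewrite x∈⁅y⁆⇒x≡y x i≡ | x∈⁅y⁆⇒x≡y x j≡ = irrefl x a

  -- Distance 4 is the span of one forcing step between centres. The bound `5 + 8 * K` is the number
  -- of vertices on a path of `4 + 8 * K` edges, the longest that has to join two forced vertices.
  module FromMaximalStable (simple : IsSimple G) (someNeighbour : ∀ v → ∃ (Adj G v))
    (Z : Subset n) (maxZ : MaximalStable Z)
    (ρ : Fin n → ℕ) (K : ℕ) (ρ≤K : ∀ x → ρ x ≤ K)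
    (proper : ∀ {x y} → Walk (Adj G) 4 x y → ρ x ≡ ρ y → x ≡ y)
    (avoids : ∀ z → z ∈ Z → ¬ InShortCore (5 + 8 * K) z) where

    open MaximalStable maxZ

    irrefl : ∀ i → ¬ Adj G i i
    irrefl = proj₁ simple

    symm : ∀ {i j} → Adj G i j → Adj G j i
    symm = proj₂ simple _ _

    topCentre : ∀ v → v ∉ Z →
      ∃ λ z → (z ∈ Z × Adj G v z) × (∀ y → y ∈ Z × Adj G v y → K ∸ ρ z ≤ K ∸ ρ y)
    -- `K ∸ ρ z` turns the search for the highest colour into a minimisation; `ρ≤K` makes this
    -- reversible.
    topCentre v v∉ = argmin (λ z → K ∸ ρ z)
      (λ m → Fin.any? λ z → ((z ∈? Z) ×-dec adj? v z) ×-dec (K ∸ ρ z <? m)) (dominating v v∉)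

    centre : Fin n → Fin n
    centre v with v ∈? Z
    -- Default on `Z`: only the centres of vertices outside `Z` enter the argument.
    ... | yes _ = v
    ... | no v∉ = proj₁ (topCentre v v∉)

    centre∈Z : ∀ {v} → v ∉ Z → centre v ∈ Z
    centre∈Z {v} v∉ with v ∈? Z
    ... | yes v∈ = ⊥-elim (v∉ v∈)
    ... | no v∉′ = proj₁ (proj₁ (proj₂ (topCentre v v∉′)))

    centre-adj : ∀ {v} → v ∉ Z → Adj G v (centre v)
    centre-adj {v} v∉ with v ∈? Z
    ... | yes v∈ = ⊥-elim (v∉ v∈)
    ... | no v∉′ = proj₂ (proj₁ (proj₂ (topCentre v v∉′)))

    centre-max : ∀ {v z} → v ∉ Z → z ∈ Z → Adj G v z → ρ z ≤ ρ (centre v)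
    centre-max {v} {z} v∉ z∈ a with v ∈? Z
    ... | yes v∈ = ⊥-elim (v∉ v∈)
    ... | no v∉′ = ∸-cancelʳ-≤ (ρ≤K z) (proj₂ (proj₂ (topCentre v v∉′)) z (z∈ , a))

    lowest : ∀ z → ∃ λ v → Adj G z v × (∀ y → Adj G z y → ρ (centre v) ≤ ρ (centre y))
    lowest z = argmin (ρ ∘ centre) (λ m → Fin.any? λ v → adj? z v ×-dec (ρ (centre v) <? m)) (someNeighbour z)

    leaf : Fin n → Fin n
    leaf z = proj₁ (lowest z)

    leaf∉Z : ∀ {z} → z ∈ Z → leaf z ∉ Z
    leaf∉Z {z} z∈ l∈ = isStable z (leaf z) z∈ l∈ (proj₁ (proj₂ (lowest z)))

    Link : Fin n → Fin n → Set
    Link z v = z ≡ centre v ⊎ v ≡ leaf z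

    link-adj : ∀ {z v} → v ∉ Z → Link z v → Adj G z v
    link-adj v∉ (inj₁ refl) = symm (centre-adj v∉)
    link-adj {z} v∉ (inj₂ refl) = proj₁ (proj₂ (lowest z))

    partner : Fin n → Fin n
    partner v with v ∈? Z
    ... | yes _ = leaf v
    ... | no _  = centre v

    pair : Fin n → Subset n
    pair v = ⁅ v ⁆ ∪ ⁅ partner v ⁆

    v∈pair : ∀ v → v ∈ pair v
    v∈pair v = x∈p∪q⁺ (inj₁ (x∈⁅x⁆ v))

    partner∈pair : ∀ v → partner v ∈ pair v
    partner∈pair v = x∈p∪q⁺ {p = ⁅ v ⁆} (inj₂ (x∈⁅x⁆ (partner v)))

    partner-adj : ∀ v → Adj G v (partner v)
    partner-adj v with v ∈? Z
    ... | yes v∈ = proj₁ (proj₂ (lowest v))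
    ... | no v∉ = centre-adj v∉

    -- Forgets from which end the clique was built, so that meeting all cliques reduces to meeting
    -- all links.
    pair-link : ∀ u → ∃ λ z → ∃ λ v → z ∈ Z × v ∉ Z × Link z v × z ∈ pair u × v ∈ pair u
    pair-link u with u ∈? Z | v∈pair u | partner∈pair u
    ... | yes u∈ | a | b = u , leaf u , u∈ , leaf∉Z u∈ , inj₂ refl , a , b
    ... | no u∉ | a | b = centre u , u , centre∈Z u∉ , u∉ , inj₁ refl , b , a

    pair-clique : ∀ v → IsClique G (pair v)
    pair-clique v i j i∈ j∈ ne with x∈p∪q⁻ ⁅ v ⁆ _ i∈ | x∈p∪q⁻ ⁅ v ⁆ _ j∈
    ... | inj₁ i≡ | inj₁ j≡ = ⊥-elim (ne (trans (x∈⁅y⁆⇒x≡y v i≡) (sym (x∈⁅y⁆⇒x≡y v j≡))))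
    ... | inj₂ i≡ | inj₂ j≡ = ⊥-elim (ne (trans (x∈⁅y⁆⇒x≡y _ i≡) (sym (x∈⁅y⁆⇒x≡y _ j≡))))
    ... | inj₁ i≡ | inj₂ j≡ rewrite x∈⁅y⁆⇒x≡y v i≡ | x∈⁅y⁆⇒x≡y _ j≡ = partner-adj v
    ... | inj₂ i≡ | inj₁ j≡ rewrite x∈⁅y⁆⇒x≡y _ i≡ | x∈⁅y⁆⇒x≡y v j≡ = symm (partner-adj v)

    Cross : Fin n → Fin n → Set
    Cross a b = Adj G a b × ((a ∈ Z × b ∉ Z) ⊎ (a ∉ Z × b ∈ Z))

    cross-symm : ∀ {a b} → Cross a b → Cross b a
    cross-symm (ab , inj₁ (a∈ , b∉)) = symm ab , inj₂ (b∉ , a∈)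
    cross-symm (ab , inj₂ (a∉ , b∈)) = symm ab , inj₁ (b∈ , a∉)

    cross-out : ∀ {a b} → a ∉ Z → Cross a b → b ∈ Z
    cross-out a∉ (_ , inj₁ (a∈ , _)) = ⊥-elim (a∉ a∈)
    cross-out a∉ (_ , inj₂ (_ , b∈)) = b∈

    -- An edge outside Z closes an alternating walk to an odd cycle through Z.
    noOddCycle : ∀ {v w m} → v ∉ Z → w ∉ Z → m ≤ 4 + 8 * K → Walk Cross m v w → ¬ Adj G v w
    noOddCycle {v} {w} v∉ w∉ m≤ walk vw with loopErase walk
    ... | l , path , len = contra
      where
      v≢w : v ≢ w
      v≢w refl = irrefl v vw
      p : Subset n
      p = toSubset l
      ∈p : ∀ {x} → x ∈ˡ l → x ∈ p
      ∈p = ∈-toSubset⁺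
      two : MinDegree2 p
      two u u∈ with pathDegrees cross-symm path (∈-toSubset⁻ l u∈)
      ... | inj₁ (e , e′) = ⊥-elim (v≢w (trans (sym e) e′))
      -- At an end of the path the edge `vw` supplies the second neighbour: the path neighbour lies
      -- in `Z`, while `v` and `w` do not.
      ... | inj₂ (inj₁ (refl , y , y∈ , uy)) = y , w , (λ { refl → w∉ (cross-out v∉ uy) }) ,
            (∈p y∈ , proj₁ uy) , (∈p (last∈ path) , vw)
      ... | inj₂ (inj₂ (inj₁ (refl , y , y∈ , uy))) = y , v , (λ { refl → v∉ (cross-out w∉ uy) }) ,
            (∈p y∈ , proj₁ uy) , (∈p (head∈ path) , symm vw)
      ... | inj₂ (inj₂ (inj₂ (x , y , ne , (x∈ , ux) , (y∈ , uy)))) =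
            x , y , ne , (∈p x∈ , proj₁ ux) , (∈p y∈ , proj₁ uy)
      small : ∣ p ∣ ≤ 5 + 8 * K
      small = ≤-trans (∣∣≤length p l (∈-toSubset⁻ l)) (≤-trans len (s≤s m≤))
      -- The path leaves `v` into `Z`, so `Z` would meet a set of minimum degree 2 with at most
      -- `5 + 8 * K` vertices.
      hit : ∀ {y} → y ∈ˡ l → Cross v y → Data.Empty.⊥
      hit y∈ vy = avoids _ (cross-out v∉ vy) (p , small , ∈p y∈ , two)
      contra : Data.Empty.⊥
      contra with pathDegrees cross-symm path (head∈ path)
      ... | inj₁ (_ , e′) = v≢w e′
      ... | inj₂ (inj₁ (_ , y , y∈ , vy)) = hit y∈ vy
      ... | inj₂ (inj₂ (inj₁ (e , _))) = v≢w e
      ... | inj₂ (inj₂ (inj₂ (x , y , ne , (x∈ , vx) , _))) = hit x∈ vx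

    -- A stable set that meets every linked pair and contains v omits z, hence contains w.
    Forces : Fin n → Fin n → Set
    Forces v w = ∃ λ z → z ∈ Z × Adj G v z × w ∉ Z × Link z w

    forces? : ∀ v w → Dec (Forces v w)
    forces? v w = Fin.any? λ z → (z ∈? Z) ×-dec adj? v z ×-dec ¬? (w ∈? Z) ×-dec
      ((z Fin.≟ centre w) ⊎-dec (w Fin.≟ leaf z))

    -- If `z` is the centre of `w`, it is also a candidate for the centre of `v`, which has the
    -- highest colour on offer. If `w` is the leaf of `z`, its centre has the lowest colour among
    -- the centres of neighbours of `z`, and `v` is such a neighbour.
    forces-ρ : ∀ {v w} → v ∉ Z → Forces v w → ρ (centre w) ≤ ρ (centre v)
    forces-ρ v∉ (z , z∈ , vz , w∉ , inj₁ refl) = centre-max v∉ z∈ vz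
    forces-ρ v∉ (z , z∈ , vz , w∉ , inj₂ refl) = proj₂ (proj₂ (lowest z)) _ (symm vz)

    -- The route is `centre v`, `v`, `z`, `w`, `centre w`; its four edges are why the colouring
    -- separates the ends of walks of length 4.
    forces-walk : ∀ {v w} → v ∉ Z → Forces v w → Walk Cross 4 (centre v) (centre w)
    forces-walk v∉ (z , z∈ , vz , w∉ , link) =
      (symm (centre-adj v∉) , inj₁ (centre∈Z v∉ , v∉)) ∷ (vz , inj₂ (v∉ , z∈)) ∷
      (link-adj w∉ link , inj₁ (z∈ , w∉)) ∷ (centre-adj w∉ , inj₂ (w∉ , centre∈Z w∉)) ∷ []

    forget : ∀ {a b m} → Walk Cross m a b → Walk (Adj G) m a b
    forget [] = []
    forget ((e , _) ∷ w) = e ∷ forget w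

    module _ (r : Fin n) (r∉ : r ∉ Z) where

      -- Each forcing step to another centre lowers ρ, which pays for the four edges walked.
      Near : Fin n → Set
      Near v = v ∉ Z × ∃ λ m → Walk Cross m r (centre v) × m + 4 * ρ (centre v) ≤ 1 + 4 * ρ (centre r)

      near-step : ∀ {v w} → Near v → Forces v w → Near w
      near-step {v} {w} (v∉ , m , walk , le) fo@(_ , _ , _ , w∉ , _) with ρ (centre w) ≟ ρ (centre v)
      -- Centres of equal colour at the ends of a four-edge walk coincide, so the old walk still
      -- serves.
      ... | yes e = w∉ , m , subst (λ c → Walk Cross m r c × m + 4 * ρ c ≤ 1 + 4 * ρ (centre r))
                      (proper (forget (forces-walk v∉ fo)) (sym e)) (walk , le)
      ... | no ne = w∉ , m + 4 , walk ++ʷ forces-walk v∉ fo , (begin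
          m + 4 + 4 * ρ (centre w)   ≡⟨ shift m (ρ (centre w)) ⟩
          m + 4 * suc (ρ (centre w)) ≤⟨ +-monoʳ-≤ m (*-monoʳ-≤ 4 (≤∧≢⇒< (forces-ρ v∉ fo) ne)) ⟩
          m + 4 * ρ (centre v)       ≤⟨ le ⟩
          1 + 4 * ρ (centre r)       ∎)
        where
        open ≤-Reasoning
        shift : ∀ m x → m + 4 + 4 * x ≡ m + 4 * suc x
        shift = solve-∀

      -- Both walks start at `r`. Each has at most `1 + 4 * K` edges, and one more edge leads from
      -- the centre to the vertex, which adds up to the length allowed in `noOddCycle`.
      near-stable : ∀ {v w} → Near v → Near w → ¬ Adj G v w
      near-stable {v} {w} (v∉ , m , walk , le) (w∉ , m′ , walk′ , le′) =
        noOddCycle v∉ w∉ bound (reverseʷ cross-symm (walk ++ʷ (toOut v∉ ∷ [])) ++ʷ walk′ ++ʷ (toOut w∉ ∷ []))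
        where
        open ≤-Reasoning
        toOut : ∀ {x} → x ∉ Z → Cross (centre x) x
        toOut x∉ = symm (centre-adj x∉) , inj₁ (centre∈Z x∉ , x∉)
        short : ∀ {k x} → k + 4 * x ≤ 1 + 4 * ρ (centre r) → k ≤ 1 + 4 * K
        short le = ≤-trans (m≤m+n _ _) (≤-trans le (s≤s (*-monoʳ-≤ 4 (ρ≤K _))))
        total : ∀ K → (1 + 4 * K + 1) + (1 + 4 * K + 1) ≡ 4 + 8 * K
        total = solve-∀
        bound : (m + 1) + (m′ + 1) ≤ 4 + 8 * K
        bound = begin
          (m + 1) + (m′ + 1)                  ≤⟨ +-mono-≤ (+-monoˡ-≤ 1 (short {m} {ρ (centre v)} le))
                                                          (+-monoˡ-≤ 1 (short {m′} {ρ (centre w)} le′)) ⟩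
          (1 + 4 * K + 1) + (1 + 4 * K + 1)   ≡⟨ total K ⟩
          4 + 8 * K                           ∎

      forcedSet : ∃ λ q → ⁅ r ⁆ ⊆ q × (∀ v → v ∈ q → Near v) × (∀ v w → v ∈ q → Forces v w → w ∈ q)
      forcedSet = saturate (λ q → ∀ v → v ∈ q → Near v) (λ q → ∀ v w → v ∈ q → Forces v w → w ∈ q) step ⁅ r ⁆ start
        where
        start : ∀ v → v ∈ ⁅ r ⁆ → Near v
        start v v∈ rewrite x∈⁅y⁆⇒x≡y r v∈ =
          -- The single edge from `r` to its centre accounts for the 1 in the bound of `Near`.
          r∉ , 1 , (centre-adj r∉ , inj₂ (r∉ , centre∈Z r∉)) ∷ [] , ≤-refl
        step : ∀ q → (∀ v → v ∈ q → Near v) → (∀ v w → v ∈ q → Forces v w → w ∈ q) ⊎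
          ∃ λ x → x ∉ q × (∀ v → v ∈ ⁅ x ⁆ ∪ q → Near v)
        step q near with Fin.any? (λ v → Fin.any? λ w → (v ∈? q) ×-dec forces? v w ×-dec ¬? (w ∈? q))
        ... | no none = inj₁ λ v w v∈ f → decidable-stable (w ∈? q) (λ w∉ → none (v , w , v∈ , f , w∉))
        ... | yes (v , w , v∈ , f , w∉) = inj₂ (w , w∉ , near′)
          where
          near′ : ∀ x → x ∈ ⁅ w ⁆ ∪ q → Near x
          near′ x x∈ with x∈p∪q⁻ ⁅ w ⁆ q x∈
          ... | inj₁ x≡ rewrite x∈⁅y⁆⇒x≡y w x≡ = near-step (near v v∈) f
          ... | inj₂ x∈q = near x x∈q

    Transversal : Fin n → Set
    Transversal v = ∃ λ S → IsStable G S × v ∈ S × (∀ u → ∃ λ w → w ∈ pair u × w ∈ S)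

    -- For `r` outside `Z` the set consists of the forced set `q` and the vertices of `Z` without a
    -- neighbour in `q`. A link `z`, `v` with `v` not in `q` is met in `z`: a neighbour of `z` in
    -- `q` would have forced `v`.
    transversal : ∀ v → Transversal v
    transversal r with r ∈? Z
    ... | yes r∈ = Z , isStable , r∈ , λ u → let z , v , z∈ , _ , _ , z∈u , _ = pair-link u in z , z∈u , z∈
    ... | no r∉ with forcedSet r r∉
    ... | q , sub , near , closed with comprehension (λ x → (x ∈? q) ⊎-dec
              ((x ∈? Z) ×-dec ¬? (Fin.any? λ v → (v ∈? q) ×-dec adj? x v)))
    ... | S , intro , elim = S , st , intro (inj₁ (sub (x∈⁅x⁆ r))) , meets
      where
      st : IsStable G S
      st i j i∈ j∈ a with elim i∈ | elim j∈
      ... | inj₁ i∈q | inj₁ j∈q = near-stable r r∉ (near i i∈q) (near j j∈q) a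
      ... | inj₁ i∈q | inj₂ (_ , free) = free (i , i∈q , symm a)
      ... | inj₂ (_ , free) | inj₁ j∈q = free (j , j∈q , a)
      ... | inj₂ (i∈Z , _) | inj₂ (j∈Z , _) = isStable i j i∈Z j∈Z a
      meets : ∀ u → ∃ λ w → w ∈ pair u × w ∈ S
      meets u with pair-link u
      ... | z , v , z∈ , v∉ , link , z∈u , v∈u with v ∈? q
      ... | yes v∈q = v , v∈u , intro (inj₁ v∈q)
      ... | no v∉q = z , z∈u , intro (inj₂ (z∈ , λ (y , y∈ , zy) →
                       v∉q (closed y v y∈ (z , z∈ , symm zy , v∉ , link))))

    normal : IsNormal G
    normal = map pair (allFin n) , map S (allFin n)
      , All.map⁺ (All.tabulate λ _ → pair-clique _)
      , All.map⁺ (All.tabulate λ {v} _ → proj₁ (proj₂ (transversal v)))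
      , (λ v → pair v , ∈-map⁺ pair (∈-allFin v) , v∈pair v)
      , (λ v → S v , ∈-map⁺ S (∈-allFin v) , proj₁ (proj₂ (proj₂ (transversal v))))
      , All.map⁺ (All.tabulate λ {u} _ → All.map⁺ (All.tabulate λ {v} _ → proj₂ (proj₂ (proj₂ (transversal v))) u))
      where
      S : Fin n → Subset n
      S v = proj₁ (transversal v)

-- Normality of tangle-free regular graphs

-- Two vertices forced by a third are joined by an alternating walk with at most 4 + 8 K edges,
-- where K = d ^ 4 is the largest colour.
coreSize : ℕ → ℕ
coreSize d = 5 + 8 * d ^ 4

-- Four cores meeting at a vertex, or two cores and two further vertices joining them.
tangleSize : ℕ → ℕ
tangleSize d = 4 * coreSize d + 2

module _ {n : ℕ} (G : AdjMat n) where

  nbrs : Fin n → List (Fin n)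
  nbrs u = elems (lookup G u)

  length-nbrs : ∀ {d} → IsRegular G d → ∀ u → length (nbrs u) ≡ d
  length-nbrs reg u = trans (length-elems (lookup G u)) (reg u)

  -- Walks with exactly `k` edges, recorded by their ends with repetition; hence the bound `d ^ k`
  -- on the length.
  sphere : ℕ → Fin n → List (Fin n)
  sphere zero x = x ∷ []
  sphere (suc k) x = concatMap (sphere k) (nbrs x)

  length-sphere : ∀ {d} → IsRegular G d → ∀ k x → length (sphere k x) ≤ d ^ k
  length-sphere reg zero x = ≤-refl
  length-sphere {d} reg (suc k) x = ≤-trans (length-concatMap≤ (sphere k) (nbrs x) (λ {y} _ → length-sphere reg k y))
    (≤-reflexive (cong (_* d ^ k) (length-nbrs reg x)))

  walk⇒sphere : ∀ {k x y} → Walk (Adj G) k x y → y ∈ˡ sphere k x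
  walk⇒sphere [] = here refl
  walk⇒sphere (e ∷ w) = ∈-concatMap (∈-elems⁺ e) (walk⇒sphere w)

  sphere⇒walk : ∀ k {x y} → y ∈ˡ sphere k x → Walk (Adj G) k x y
  sphere⇒walk zero (here refl) = []
  sphere⇒walk (suc k) {x} y∈ with find (∈-concatMap⁻ (sphere k) {xs = nbrs x} y∈)
  ... | z , z∈ , y∈′ = ∈-elems⁻ _ z∈ ∷ sphere⇒walk k y∈′

  tangleFree⇒normal : ∀ {d} → 3 ≤ d → IsSimple G → IsRegular G d →
    (∀ p → ∣ p ∣ ≤ tangleSize d → ¬ Tangle G p) → IsNormal G
  tangleFree⇒normal {d} 3≤d simple reg tangleFree = fromRim (comprehension rim?)
    where
    irrefl = proj₁ simple
    symm : ∀ {i j} → Adj G i j → Adj G j i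
    symm = proj₂ simple _ _
    g : ℕ
    g = coreSize d

    threeNeighbours : ∀ u → ∃ λ a → ∃ λ b → ∃ λ c → (a ≢ b × a ≢ c × b ≢ c) × Adj G u a × Adj G u b × Adj G u c
    threeNeighbours u with nbrs u in eq | elems-unique (lookup G u) | subst (3 ≤_) (sym (length-nbrs reg u)) 3≤d
    ... | a ∷ b ∷ c ∷ _ | (ab ∷ ac ∷ _) ∷ (bc ∷ _) ∷ _ | _ =
      a , b , c , (ab , ac , bc) , mem (here refl) , mem (there (here refl)) , mem (there (there (here refl)))
      where
      mem : ∀ {x} → x ∈ˡ a ∷ b ∷ c ∷ _ → Adj G u x
      mem x∈ = ∈-elems⁻ (lookup G u) (subst (_ ∈ˡ_) (sym eq) x∈)
    ... | [] | _ | ()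
    ... | _ ∷ [] | _ | s≤s ()
    ... | _ ∷ _ ∷ [] | _ | s≤s (s≤s ())

    InCore : Fin n → Set
    InCore = InShortCore G g

    -- Were all neighbours of `u` in cores, the cores of `u` and of three neighbours would unite to
    -- a set of minimum degree 2 in which `u` has degree at least 3: a tangle on at most `4 * g`
    -- vertices.
    exit : ∀ {u} → InCore u → ∃ λ w → Adj G u w × ¬ InCore w
    exit {u} (p , p≤ , u∈ , mp) with Fin.any? (λ w → adj? G u w ×-dec ¬? (inShortCore? G g w))
    ... | yes e = e
    ... | no none = ⊥-elim (tangleFree q small (mq , u , in₁ (in₁ (in₁ u∈)) , a , b , c , distinct ,
                      (in₁ (in₁ (in₂ p a∈)) , ua) , (in₁ (in₂ (p ∪ pa) b∈) , ub) , (in₂ ((p ∪ pa) ∪ pb) c∈ , uc)))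
      where
      core : ∀ {w} → Adj G u w → InCore w
      core uw = decidable-stable (inShortCore? G g _) (λ ¬c → none (_ , uw , ¬c))
      in₁ : ∀ {p q : Subset n} → p ⊆ p ∪ q
      in₁ {q = q} = p⊆p∪q q
      in₂ : ∀ (p : Subset n) {q} → q ⊆ p ∪ q
      in₂ p {q} = q⊆p∪q p q
      three = threeNeighbours u
      a = proj₁ three
      b = proj₁ (proj₂ three)
      c = proj₁ (proj₂ (proj₂ three))
      distinct = proj₁ (proj₂ (proj₂ (proj₂ three)))
      ua = proj₁ (proj₂ (proj₂ (proj₂ (proj₂ three))))
      ub = proj₁ (proj₂ (proj₂ (proj₂ (proj₂ (proj₂ three)))))
      uc = proj₂ (proj₂ (proj₂ (proj₂ (proj₂ (proj₂ three)))))
      pa = proj₁ (core ua)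
      pb = proj₁ (core ub)
      pc = proj₁ (core uc)
      a∈ = proj₁ (proj₂ (proj₂ (core ua)))
      b∈ = proj₁ (proj₂ (proj₂ (core ub)))
      c∈ = proj₁ (proj₂ (proj₂ (core uc)))
      q : Subset n
      q = ((p ∪ pa) ∪ pb) ∪ pc
      mq : MinDegree2 G q
      mq = minDegree2-∪ G (minDegree2-∪ G (minDegree2-∪ G mp (proj₂ (proj₂ (proj₂ (core ua)))))
             (proj₂ (proj₂ (proj₂ (core ub))))) (proj₂ (proj₂ (proj₂ (core uc))))
      total : ∀ g → g + g + g + g ≤ 4 * g + 2
      total g = ≤-trans (≤-reflexive (lem g)) (m≤m+n _ 2)
        where
        lem : ∀ g → g + g + g + g ≡ 4 * g
        lem = solve-∀
      small : ∣ q ∣ ≤ tangleSize d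
      small = begin
        ∣ q ∣                             ≤⟨ ∣p∪q∣≤∣p∣+∣q∣ ((p ∪ pa) ∪ pb) pc ⟩
        ∣ (p ∪ pa) ∪ pb ∣ + ∣ pc ∣        ≤⟨ +-monoˡ-≤ _ (∣p∪q∣≤∣p∣+∣q∣ (p ∪ pa) pb) ⟩
        ∣ p ∪ pa ∣ + ∣ pb ∣ + ∣ pc ∣      ≤⟨ +-monoˡ-≤ _ (+-monoˡ-≤ _ (∣p∪q∣≤∣p∣+∣q∣ p pa)) ⟩
        ∣ p ∣ + ∣ pa ∣ + ∣ pb ∣ + ∣ pc ∣  ≤⟨ +-mono-≤ (+-mono-≤ (+-mono-≤ p≤ (proj₁ (proj₂ (core ua))))
                                               (proj₁ (proj₂ (core ub)))) (proj₁ (proj₂ (core uc))) ⟩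
        g + g + g + g                     ≤⟨ total g ⟩
        4 * g + 2                         ∎
        where open ≤-Reasoning

    Rim : Fin n → Set
    Rim w = ¬ InCore w × ∃ λ u → InCore u × Adj G w u

    rim? : Decidable Rim
    rim? w = ¬? (inShortCore? G g w) ×-dec Fin.any? λ u → inShortCore? G g u ×-dec adj? G w u

    -- An edge `ww′` would connect the cores through `u`, `w`, `w′`, `u′`. Adding `w` and `w′` to
    -- the cores keeps minimum degree 2 and gives `u` the third neighbour `w`, which lies outside
    -- its core.
    rim-stable : ∀ {w w′} → Rim w → Rim w′ → ¬ Adj G w w′
    rim-stable {w} {w′} (w∉ , u , cu@(p , p≤ , u∈ , mp) , wu) (w′∉ , u′ , cu′@(p′ , p′≤ , u′∈ , mp′) , wu′) ww′ =
      tangleFree q small (mq , u , inP u∈ , a , b , w ,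
        (a≢b , (λ { refl → w∉p a∈ }) , (λ { refl → w∉p b∈ })) ,
        (inP a∈ , ua) , (inP b∈ , ub) , (inW (here refl) , symm wu))
      where
      r q : Subset n
      r = toSubset (w ∷ w′ ∷ [])
      q = (p ∪ p′) ∪ r
      inP : p ⊆ q
      inP = p⊆p∪q r ∘ p⊆p∪q p′
      inP′ : p′ ⊆ q
      inP′ = p⊆p∪q r ∘ q⊆p∪q p p′
      inW : ∀ {x} → x ∈ˡ w ∷ w′ ∷ [] → x ∈ q
      inW = q⊆p∪q (p ∪ p′) r ∘ ∈-toSubset⁺
      w∉p : w ∉ p
      w∉p w∈ = w∉ (p , p≤ , w∈ , mp)
      a = proj₁ (mp u u∈)
      b = proj₁ (proj₂ (mp u u∈))
      a≢b = proj₁ (proj₂ (proj₂ (mp u u∈)))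
      a∈ = proj₁ (proj₁ (proj₂ (proj₂ (proj₂ (mp u u∈)))))
      ua = proj₂ (proj₁ (proj₂ (proj₂ (proj₂ (mp u u∈)))))
      b∈ = proj₁ (proj₂ (proj₂ (proj₂ (proj₂ (mp u u∈)))))
      ub = proj₂ (proj₂ (proj₂ (proj₂ (proj₂ (mp u u∈)))))
      mq : MinDegree2 G q
      mq x x∈ with x∈p∪q⁻ (p ∪ p′) r x∈
      ... | inj₁ x∈pp′ = twoMono G (p⊆p∪q r) (minDegree2-∪ G mp mp′ x x∈pp′)
      ... | inj₂ x∈r with ∈-toSubset⁻ (w ∷ w′ ∷ []) x∈r
      ... | here refl = u , w′ , (λ { refl → w′∉ cu }) , (inP u∈ , wu) , (inW (there (here refl)) , ww′)
      ... | there (here refl) = u′ , w , (λ { refl → w∉ cu′ }) , (inP′ u′∈ , wu′) , (inW (here refl) , symm ww′)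
      small : ∣ q ∣ ≤ tangleSize d
      small = begin
        ∣ q ∣                    ≤⟨ ∣p∪q∣≤∣p∣+∣q∣ (p ∪ p′) r ⟩
        ∣ p ∪ p′ ∣ + ∣ r ∣       ≤⟨ +-mono-≤ (∣p∪q∣≤∣p∣+∣q∣ p p′) (∣∣≤length r (w ∷ w′ ∷ []) (∈-toSubset⁻ _)) ⟩
        ∣ p ∣ + ∣ p′ ∣ + 2       ≤⟨ +-monoˡ-≤ 2 (+-mono-≤ p≤ p′≤) ⟩
        g + g + 2                ≤⟨ +-monoˡ-≤ 2 (+-monoʳ-≤ g (m≤m+n g _)) ⟩
        4 * g + 2                ∎
        where open ≤-Reasoning

    fromColouring : (∃ λ (ρ : Fin n → ℕ) → (∀ x → ρ x ≤ d ^ 4) × (∀ x y → y ∈ˡ sphere 4 x → ρ x ≡ ρ y → x ≡ y)) →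
      ∀ Z → MaximalStable G Z → (∀ z → z ∈ Z → ¬ InCore z) → IsNormal G
    fromColouring (ρ , ρ≤ , proper) Z maxZ avoids = FromMaximalStable.normal G simple
      (λ v → let a , _ , _ , _ , va , _ = threeNeighbours v in a , va)
      Z maxZ ρ (d ^ 4) ρ≤ (λ w → proper _ _ (walk⇒sphere w)) avoids

    fromRim : (∃ λ W → (∀ {x} → Rim x → x ∈ W) × (∀ {x} → x ∈ W → Rim x)) → IsNormal G
    fromRim (W , intro , elim) with extendStable G simple W (λ i j i∈ j∈ → rim-stable (elim i∈) (elim j∈))
    ... | Z , W⊆Z , maxZ = fromColouring
      -- At most `d ^ 4` walks of length 4 start at a vertex, which leaves a colour free among 0 to
      -- `d ^ 4`.
      (greedyColouring (sphere 4) (d ^ 4) (length-sphere reg 4)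
        (λ {x} y∈ → walk⇒sphere (reverseʷ symm (sphere⇒walk 4 {x} y∈)))) Z maxZ avoids
      where
      avoids : ∀ z → z ∈ Z → ¬ InCore z
      avoids z z∈ cz with exit cz
      -- The neighbour `w` provided by `exit` belongs to the rim, hence to `Z`, against stability.
      ... | w , zw , w∉ = MaximalStable.isStable maxZ z w z∈ (W⊆Z (intro (w∉ , z , cz , symm zw))) zw

-- Switchings

module _ {A B : Set} where

  pairs : (A → List B) → List A → List (A × B)
  pairs f = concatMap (λ a → map (a ,_) (f a))

  ∈-pairs⁺ : ∀ {f as a b} → a ∈ˡ as → b ∈ˡ f a → (a , b) ∈ˡ pairs f as
  ∈-pairs⁺ a∈ b∈ = ∈-concatMap a∈ (∈-map⁺ _ b∈)

  ∈-pairs⁻ : ∀ f as {c} → c ∈ˡ pairs f as → proj₁ c ∈ˡ as × proj₂ c ∈ˡ f (proj₁ c)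
  ∈-pairs⁻ f as c∈ with find (∈-concatMap⁻ (λ a → map (a ,_) (f a)) {xs = as} c∈)
  ... | a , a∈ , c∈′ with ∈-map⁻ (a ,_) c∈′
  ... | b , b∈ , refl = a∈ , b∈

  pairs-unique : ∀ {f as} → Unique as → (∀ a → Unique (f a)) → Unique (pairs f as)
  pairs-unique [] uf = []
  pairs-unique {f} {a ∷ as} (a∉ ∷ u) uf =
    Uniq.++⁺ (Uniq.map⁺ (λ { refl → refl }) (uf a)) (pairs-unique u uf) disjoint
    where
    disjoint : ∀ {c} → c ∈ˡ map (a ,_) (f a) × c ∈ˡ pairs f as → Data.Empty.⊥
    disjoint (c∈ , c∈′) with ∈-map⁻ (a ,_) c∈
    ... | b , b∈ , refl = All.lookup a∉ (proj₁ (∈-pairs⁻ f as c∈′)) refl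

  -- This and the upper bound after it are the two sides of the double count of switchings.
  length-pairs≥ : ∀ {f k} as → (∀ {a} → a ∈ˡ as → k ≤ length (f a)) → length as * k ≤ length (pairs f as)
  length-pairs≥ [] _ = z≤n
  length-pairs≥ {f} {k} (a ∷ as) h = begin
    k + length as * k                                   ≤⟨ +-mono-≤ (h (here refl)) (length-pairs≥ as (h ∘ there)) ⟩
    length (f a) + length (pairs f as)                  ≡⟨ cong (_+ _) (sym (length-map (a ,_) (f a))) ⟩
    length (map (a ,_) (f a)) + length (pairs f as)     ≡⟨ sym (length-++ (map (a ,_) (f a))) ⟩
    length (map (a ,_) (f a) ++ pairs f as)             ∎
    where open ≤-Reasoning

  length-pairs≤ : ∀ {f k} as → (∀ {a} → a ∈ˡ as → length (f a) ≤ k) → length (pairs f as) ≤ length as * k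
  length-pairs≤ {f} as h = length-concatMap≤ _ as
    (λ {a} a∈ → ≤-trans (≤-reflexive (length-map (a ,_) (f a))) (h a∈))

-- Models a neighbourhood changed by a switching: one vertex leaves and one enters. Exchanging the
-- roles of the two sets and of `a` and `b` turns one inequality into the other.
∣∣-exchange : ∀ {n} {p q : Subset n} {a b} → a ∈ p → b ∉ p → a ∉ q → b ∈ q →
  (∀ j → j ≢ a → j ≢ b → (j ∈ p → j ∈ q) × (j ∈ q → j ∈ p)) → ∣ p ∣ ≡ ∣ q ∣
∣∣-exchange {p = p} {q} a∈p b∉p a∉q b∈q agree =
  ≤-antisym (half a∈p b∉p b∈q (λ j na nb → proj₁ (agree j na nb)))
            (half b∈q a∉q a∈p (λ j nb na → proj₂ (agree j na nb)))
  where
  half : ∀ {n} {p q : Subset n} {a b} → a ∈ p → b ∉ p → b ∈ q →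
    (∀ j → j ≢ a → j ≢ b → j ∈ p → j ∈ q) → ∣ p ∣ ≤ ∣ q ∣
  half {p = p} {q} {a} {b} a∈p b∉p b∈q agree = s≤s⁻¹ (begin
    suc ∣ p ∣             ≡⟨ cong suc (sym (length-elems p)) ⟩
    length (b ∷ elems p)  ≤⟨ length-mono-⊆ (All.tabulate (λ j∈ e → b∉p (∈-elems⁻ p (subst (_∈ˡ elems p) (sym e) j∈))) ∷ elems-unique p) sub ⟩
    length (a ∷ elems q)  ≡⟨ cong suc (length-elems q) ⟩
    suc ∣ q ∣             ∎)
    where
    open ≤-Reasoning
    sub : ∀ {j} → j ∈ˡ b ∷ elems p → j ∈ˡ a ∷ elems q
    sub (here refl) = there (∈-elems⁺ b∈q)
    sub {j} (there j∈) with j Fin.≟ a | j Fin.≟ b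
    ... | yes e | _ = here e
    ... | no _ | yes refl = there (∈-elems⁺ b∈q)
    ... | no na | no nb = there (∈-elems⁺ (agree j na nb (∈-elems⁻ p j∈)))

length-filter-∉ : ∀ {n} (xs : List (Fin n)) →
  n ∸ length xs ≤ length (filter (λ x → ¬? (Any.any? (x Fin.≟_) xs)) (allFin n))
length-filter-∉ {n} xs = m≤n+o⇒m∸n≤o n (length xs) (begin
  n                                      ≡⟨ sym (length-tabulate id) ⟩
  length (allFin n)                      ≤⟨ length-mono-⊆ (Uniq.allFin⁺ n) split ⟩
  length (xs ++ filter out? (allFin n))  ≡⟨ length-++ xs ⟩
  length xs + length (filter out? (allFin n)) ∎)
  where
  open ≤-Reasoning
  out? : Decidable (_∉ˡ xs)
  out? x = ¬? (Any.any? (x Fin.≟_) xs)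
  split : ∀ {x} → x ∈ˡ allFin n → x ∈ˡ xs ++ filter out? (allFin n)
  split {x} x∈ with Any.any? (x Fin.≟_) xs
  ... | yes p = ∈-++⁺ˡ p
  ... | no ¬p = ∈-++⁺ʳ xs (∈-filter⁺ out? x∈ ¬p)

module _ {n : ℕ} where

  Edge : Set
  Edge = Fin n × Fin n

  -- Edges are stored as ordered pairs; this is equality of the unordered pairs beneath.
  SamePair : Edge → Edge → Set
  SamePair (a , b) (i , j) = (i ≡ a × j ≡ b) ⊎ (i ≡ b × j ≡ a)

  samePair? : ∀ e f → Dec (SamePair e f)
  samePair? (a , b) (i , j) = ((i Fin.≟ a) ×-dec (j Fin.≟ b)) ⊎-dec ((i Fin.≟ b) ×-dec (j Fin.≟ a))

  samePair-flip : ∀ {a b i j} → SamePair (a , b) (i , j) → SamePair (a , b) (j , i)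
  samePair-flip (inj₁ (p , q)) = inj₂ (q , p)
  samePair-flip (inj₂ (p , q)) = inj₁ (q , p)

  Distinct : List Edge → Set
  Distinct = AllPairs (λ e f → ¬ SamePair e f)

  Contains : List Edge → AdjMat n → Set
  Contains E G = All (λ e → Adj G (proj₁ e) (proj₂ e)) E

  contains? : ∀ E → Decidable (Contains E)
  contains? E G = All.all? (λ e → adj? G (proj₁ e) (proj₂ e)) E

  -- Adding an indicator matrix modulo 2 is its own inverse, which makes a switching with known `u`,
  -- `v`, `x`, `y` reversible.
  toggle : {T : Fin n → Fin n → Set} → (∀ i j → Dec (T i j)) → AdjMat n → AdjMat n
  toggle T? G = tabulate λ i → tabulate λ j → lookup (lookup G i) j xor does (T? i j)

  module _ {T : Fin n → Fin n → Set} (T? : ∀ i j → Dec (T i j)) where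

    lookup-toggle : ∀ G i j → lookup (lookup (toggle T? G) i) j ≡ lookup (lookup G i) j xor does (T? i j)
    lookup-toggle G i j = trans (cong (λ r → lookup r j) (Vec.lookup∘tabulate _ i)) (Vec.lookup∘tabulate _ j)

    toggle-on : ∀ G {i j} → ¬ Adj G i j → T i j → Adj (toggle T? G) i j
    toggle-on G {i} {j} ¬a t = Vec.lookup⇒[]= j _ (trans (lookup-toggle G i j) (flip (T? i j)))
      where
      flip : (D : Dec (T i j)) → lookup (lookup G i) j xor does D ≡ true
      flip (no ¬t) = ⊥-elim (¬t t)
      flip (yes _) with lookup (lookup G i) j in eq
      ... | false = refl
      ... | true = ⊥-elim (¬a (Vec.lookup⇒[]= j _ eq))

    toggle-keep : ∀ G {i j} → Adj G i j → ¬ T i j → Adj (toggle T? G) i j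
    toggle-keep G {i} {j} a ¬t = Vec.lookup⇒[]= j _ (trans (lookup-toggle G i j) (keep (T? i j)))
      where
      keep : (D : Dec (T i j)) → lookup (lookup G i) j xor does D ≡ true
      keep (yes t) = ⊥-elim (¬t t)
      keep (no _) rewrite Vec.[]=⇒lookup a = refl

    toggle⁻ : ∀ G {i j} → Adj (toggle T? G) i j → (Adj G i j × ¬ T i j) ⊎ (¬ Adj G i j × T i j)
    toggle⁻ G {i} {j} a = look (T? i j) (trans (sym (lookup-toggle G i j)) (Vec.[]=⇒lookup a))
      where
      look : (D : Dec (T i j)) → lookup (lookup G i) j xor does D ≡ true → (Adj G i j × ¬ T i j) ⊎ (¬ Adj G i j × T i j)
      look (no ¬t) e = inj₁ (Vec.lookup⇒[]= j _ (trans (sym (Bool.xor-identityʳ _)) e) , ¬t)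
      look (yes t) e = inj₂ ((λ a′ → contradiction (trans (sym e) (cong (_xor true) (Vec.[]=⇒lookup a′))) λ ()) , t)

    toggle-injective : ∀ G H → toggle T? G ≡ toggle T? H → G ≡ H
    toggle-injective G H e = ext λ i → ext λ j → cancel _ _ (does (T? i j))
        (trans (sym (lookup-toggle G i j)) (trans (cong (λ K → lookup (lookup K i) j) e) (lookup-toggle H i j)))
      where
      ext : {A : Set} {xs ys : Vec.Vec A n} → (∀ i → lookup xs i ≡ lookup ys i) → xs ≡ ys
      ext {xs = xs} {ys} h = trans (sym (Vec.tabulate∘lookup xs)) (trans (Vec.tabulate-cong h) (Vec.tabulate∘lookup ys))
      cancel : ∀ a b c → a xor c ≡ b xor c → a ≡ b
      cancel false false _ _ = refl
      cancel true true _ _ = refl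
      cancel false true false ()
      cancel false true true ()
      cancel true false false ()
      cancel true false true ()

  module _ (u v x y : Fin n) where

    -- The left summand holds the edges to be deleted, the right one those to be added.
    Switched : Fin n → Fin n → Set
    Switched i j = (SamePair (u , v) (i , j) ⊎ SamePair (x , y) (i , j)) ⊎
                   (SamePair (u , x) (i , j) ⊎ SamePair (v , y) (i , j))

    switched? : ∀ i j → Dec (Switched i j)
    switched? i j = (samePair? _ _ ⊎-dec samePair? _ _) ⊎-dec (samePair? _ _ ⊎-dec samePair? _ _)

    switched-symm : ∀ {i j} → Switched i j → Switched j i
    switched-symm (inj₁ (inj₁ s)) = inj₁ (inj₁ (samePair-flip s))
    switched-symm (inj₁ (inj₂ s)) = inj₁ (inj₂ (samePair-flip s))
    switched-symm (inj₂ (inj₁ s)) = inj₂ (inj₁ (samePair-flip s))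
    switched-symm (inj₂ (inj₂ s)) = inj₂ (inj₂ (samePair-flip s))

    switch : AdjMat n → AdjMat n
    switch = toggle switched?

    module SwitchProperties (G : AdjMat n) (simple : IsSimple G) (uv : Adj G u v) (xy : Adj G x y)
      (x≢u : x ≢ u) (y≢v : y ≢ v) (¬ux : ¬ Adj G u x) (¬vy : ¬ Adj G v y) where

      private
        irrefl = proj₁ simple
        symm : ∀ {i j} → Adj G i j → Adj G j i
        symm = proj₂ simple _ _

        u≢v : u ≢ v
        u≢v refl = irrefl u uv
        x≢y : x ≢ y
        x≢y refl = irrefl x xy
        x≢v : x ≢ v
        x≢v refl = ¬ux uv
        y≢u : y ≢ u
        y≢u refl = ¬vy (symm uv)

      switch-ux : Adj (switch G) u x
      switch-ux = toggle-on switched? G ¬ux (inj₂ (inj₁ (inj₁ (refl , refl))))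

      switch-vy : Adj (switch G) v y
      switch-vy = toggle-on switched? G ¬vy (inj₂ (inj₂ (inj₁ (refl , refl))))

      switch-simple : IsSimple (switch G)
      switch-simple = noLoop , sym′
        where
        noLoop : ∀ i → ¬ Adj (switch G) i i
        noLoop i a with toggle⁻ switched? G a
        ... | inj₁ (b , _) = irrefl i b
        ... | inj₂ (_ , inj₁ (inj₁ (inj₁ (p , q)))) = u≢v (trans (sym p) q)
        ... | inj₂ (_ , inj₁ (inj₁ (inj₂ (p , q)))) = u≢v (trans (sym q) p)
        ... | inj₂ (_ , inj₁ (inj₂ (inj₁ (p , q)))) = x≢y (trans (sym p) q)
        ... | inj₂ (_ , inj₁ (inj₂ (inj₂ (p , q)))) = x≢y (trans (sym q) p)
        ... | inj₂ (_ , inj₂ (inj₁ (inj₁ (p , q)))) = x≢u (trans (sym q) p)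
        ... | inj₂ (_ , inj₂ (inj₁ (inj₂ (p , q)))) = x≢u (trans (sym p) q)
        ... | inj₂ (_ , inj₂ (inj₂ (inj₁ (p , q)))) = y≢v (trans (sym q) p)
        ... | inj₂ (_ , inj₂ (inj₂ (inj₂ (p , q)))) = y≢v (trans (sym p) q)
        sym′ : ∀ i j → Adj (switch G) i j → Adj (switch G) j i
        sym′ i j a with toggle⁻ switched? G a
        ... | inj₁ (b , ¬s) = toggle-keep switched? G (symm b) (¬s ∘ switched-symm)
        ... | inj₂ (¬b , s) = toggle-on switched? G (¬b ∘ symm) (switched-symm s)

      private
        exchange : ∀ i {a b} → Adj G i a → ¬ Adj G i b → Switched i a → Switched i b →
          (∀ j → Switched i j → j ≡ a ⊎ j ≡ b) → ∣ lookup G i ∣ ≡ ∣ lookup (switch G) i ∣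
        exchange i {a} {b} ia ¬ib sa sb only = ∣∣-exchange {p = lookup G i} {lookup (switch G) i} ia ¬ib gone (toggle-on switched? G ¬ib sb) agree
          where
          gone : ¬ Adj (switch G) i a
          gone a′ with toggle⁻ switched? G a′
          ... | inj₁ (_ , ¬s) = ¬s sa
          ... | inj₂ (¬ia , _) = ¬ia ia
          agree : ∀ j → j ≢ a → j ≢ b → (Adj G i j → Adj (switch G) i j) × (Adj (switch G) i j → Adj G i j)
          agree j j≢a j≢b = (λ ij → toggle-keep switched? G ij ¬s) , back
            where
            ¬s : ¬ Switched i j
            ¬s s with only j s
            ... | inj₁ e = j≢a e
            ... | inj₂ e = j≢b e
            back : Adj (switch G) i j → Adj G i j
            back a′ with toggle⁻ switched? G a′
            ... | inj₁ (ij , _) = ij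
            ... | inj₂ (_ , s) = ⊥-elim (¬s s)

        only-u : ∀ j → Switched u j → j ≡ v ⊎ j ≡ x
        only-u j (inj₁ (inj₁ (inj₁ (_ , q)))) = inj₁ q
        only-u j (inj₁ (inj₁ (inj₂ (p , _)))) = ⊥-elim (u≢v p)
        only-u j (inj₁ (inj₂ (inj₁ (p , _)))) = ⊥-elim (x≢u (sym p))
        only-u j (inj₁ (inj₂ (inj₂ (p , _)))) = ⊥-elim (y≢u (sym p))
        only-u j (inj₂ (inj₁ (inj₁ (_ , q)))) = inj₂ q
        only-u j (inj₂ (inj₁ (inj₂ (p , _)))) = ⊥-elim (x≢u (sym p))
        only-u j (inj₂ (inj₂ (inj₁ (p , _)))) = ⊥-elim (u≢v p)
        only-u j (inj₂ (inj₂ (inj₂ (p , _)))) = ⊥-elim (y≢u (sym p))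

        only-v : ∀ j → Switched v j → j ≡ u ⊎ j ≡ y
        only-v j (inj₁ (inj₁ (inj₁ (p , _)))) = ⊥-elim (u≢v (sym p))
        only-v j (inj₁ (inj₁ (inj₂ (_ , q)))) = inj₁ q
        only-v j (inj₁ (inj₂ (inj₁ (p , _)))) = ⊥-elim (x≢v (sym p))
        only-v j (inj₁ (inj₂ (inj₂ (p , _)))) = ⊥-elim (y≢v (sym p))
        only-v j (inj₂ (inj₁ (inj₁ (p , _)))) = ⊥-elim (u≢v (sym p))
        only-v j (inj₂ (inj₁ (inj₂ (p , _)))) = ⊥-elim (x≢v (sym p))
        only-v j (inj₂ (inj₂ (inj₁ (_ , q)))) = inj₂ q
        only-v j (inj₂ (inj₂ (inj₂ (p , _)))) = ⊥-elim (y≢v (sym p))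

        only-x : ∀ j → Switched x j → j ≡ y ⊎ j ≡ u
        only-x j (inj₁ (inj₁ (inj₁ (p , _)))) = ⊥-elim (x≢u p)
        only-x j (inj₁ (inj₁ (inj₂ (p , _)))) = ⊥-elim (x≢v p)
        only-x j (inj₁ (inj₂ (inj₁ (_ , q)))) = inj₁ q
        only-x j (inj₁ (inj₂ (inj₂ (p , _)))) = ⊥-elim (x≢y p)
        only-x j (inj₂ (inj₁ (inj₁ (p , _)))) = ⊥-elim (x≢u p)
        only-x j (inj₂ (inj₁ (inj₂ (_ , q)))) = inj₂ q
        only-x j (inj₂ (inj₂ (inj₁ (p , _)))) = ⊥-elim (x≢v p)
        only-x j (inj₂ (inj₂ (inj₂ (p , _)))) = ⊥-elim (x≢y p)

        only-y : ∀ j → Switched y j → j ≡ x ⊎ j ≡ v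
        only-y j (inj₁ (inj₁ (inj₁ (p , _)))) = ⊥-elim (y≢u p)
        only-y j (inj₁ (inj₁ (inj₂ (p , _)))) = ⊥-elim (y≢v p)
        only-y j (inj₁ (inj₂ (inj₁ (p , _)))) = ⊥-elim (x≢y (sym p))
        only-y j (inj₁ (inj₂ (inj₂ (_ , q)))) = inj₁ q
        only-y j (inj₂ (inj₁ (inj₁ (p , _)))) = ⊥-elim (y≢u p)
        only-y j (inj₂ (inj₁ (inj₂ (p , _)))) = ⊥-elim (x≢y (sym p))
        only-y j (inj₂ (inj₂ (inj₁ (p , _)))) = ⊥-elim (y≢v p)
        only-y j (inj₂ (inj₂ (inj₂ (_ , q)))) = inj₂ q

        elsewhere : ∀ {i} → i ≢ u → i ≢ v → i ≢ x → i ≢ y → ∀ {j} → ¬ Switched i j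
        elsewhere i≢u i≢v i≢x i≢y (inj₁ (inj₁ (inj₁ (p , _)))) = i≢u p
        elsewhere i≢u i≢v i≢x i≢y (inj₁ (inj₁ (inj₂ (p , _)))) = i≢v p
        elsewhere i≢u i≢v i≢x i≢y (inj₁ (inj₂ (inj₁ (p , _)))) = i≢x p
        elsewhere i≢u i≢v i≢x i≢y (inj₁ (inj₂ (inj₂ (p , _)))) = i≢y p
        elsewhere i≢u i≢v i≢x i≢y (inj₂ (inj₁ (inj₁ (p , _)))) = i≢u p
        elsewhere i≢u i≢v i≢x i≢y (inj₂ (inj₁ (inj₂ (p , _)))) = i≢x p
        elsewhere i≢u i≢v i≢x i≢y (inj₂ (inj₂ (inj₁ (p , _)))) = i≢v p
        elsewhere i≢u i≢v i≢x i≢y (inj₂ (inj₂ (inj₂ (p , _)))) = i≢y p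

      -- The edges of the 4-cycle `u`, `v`, `y`, `x` are alternately deleted and added, so each
      -- corner loses one neighbour and gains one; all other rows stay the same.
      switch-degree : ∀ i → ∣ lookup G i ∣ ≡ ∣ lookup (switch G) i ∣
      switch-degree i with i Fin.≟ u | i Fin.≟ v | i Fin.≟ x | i Fin.≟ y
      ... | yes refl | _ | _ | _ = exchange u uv ¬ux (inj₁ (inj₁ (inj₁ (refl , refl)))) (inj₂ (inj₁ (inj₁ (refl , refl)))) only-u
      ... | no _ | yes refl | _ | _ = exchange v (symm uv) ¬vy (inj₁ (inj₁ (inj₂ (refl , refl)))) (inj₂ (inj₂ (inj₁ (refl , refl)))) only-v
      ... | no _ | no _ | yes refl | _ = exchange x xy (¬ux ∘ symm) (inj₁ (inj₂ (inj₁ (refl , refl)))) (inj₂ (inj₁ (inj₂ (refl , refl)))) only-x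
      ... | no _ | no _ | no _ | yes refl = exchange y (symm xy) (¬vy ∘ symm) (inj₁ (inj₂ (inj₂ (refl , refl)))) (inj₂ (inj₂ (inj₂ (refl , refl)))) only-y
      ... | no a | no b | no c | no d = ≤-antisym (p⊆q⇒∣p∣≤∣q∣ (λ ij → toggle-keep switched? G ij (elsewhere a b c d)))
                                                  (p⊆q⇒∣p∣≤∣q∣ back)
        where
        back : ∀ {j} → Adj (switch G) i j → Adj G i j
        back a′ with toggle⁻ switched? G a′
        ... | inj₁ (ij , _) = ij
        ... | inj₂ (_ , s) = ⊥-elim (elsewhere a b c d s)

  -- Counting graphs that contain prescribed edges

  endpoints : List Edge → List (Fin n)
  endpoints = concatMap (λ e → proj₁ e ∷ proj₂ e ∷ [])

  length-endpoints : ∀ E → length (endpoints E) ≤ length E * 2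
  length-endpoints E = length-concatMap≤ _ E (λ _ → ≤-refl)

  -- One chosen neighbour `y` per `x` suffices, since the choices of `x` alone already number about
  -- `n`. The value `x` at an empty neighbourhood is a default that regularity of positive degree
  -- excludes.
  firstNbr : AdjMat n → Fin n → Fin n
  firstNbr G x with nbrs G x
  ... | [] = x
  ... | y ∷ _ = y

  firstNbr-adj : ∀ G {d} → IsRegular G d → 1 ≤ d → ∀ x → Adj G x (firstNbr G x)
  firstNbr-adj G reg 1≤d x with nbrs G x in eq | subst (1 ≤_) (sym (length-nbrs G reg x)) 1≤d
  ... | y ∷ ys | _ = ∈-elems⁻ (lookup G x) (subst (y ∈ˡ_) (sym eq) (here refl))
  ... | [] | ()

  module Switching {d : ℕ} (1≤d : 1 ≤ d) {L : List (AdjMat n)} (enum : Enumerates n d L) where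

    containing : List Edge → List (AdjMat n)
    containing E = filter (contains? E) L

    module _ (u v : Fin n) (E : List Edge) (sep : All (λ f → ¬ SamePair (u , v) f) E) where

      -- The entries exclude in turn: `x` equal to `u`; `ux` already an edge; `y` equal to `v`; `vy`
      -- already an edge; the deleted edge `xy` belonging to `E`.
      blocked : AdjMat n → List (Fin n)
      blocked G = u ∷ nbrs G u ++ nbrs G v ++ sphere G 2 v ++ endpoints E

      blockedBound : ℕ
      blockedBound = 1 + (d + (d + (d ^ 2 + length E * 2)))

      length-blocked : ∀ G → IsRegular G d → length (blocked G) ≤ blockedBound
      length-blocked G reg = s≤s (append (nbrs G u) (≤-reflexive (length-nbrs G reg u))
        (append (nbrs G v) (≤-reflexive (length-nbrs G reg v))
        (append (sphere G 2 v) (length-sphere G reg 2 v) (length-endpoints E))))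
        where
        append : ∀ {a b} (xs : List (Fin n)) {ys} → length xs ≤ a → length ys ≤ b → length (xs ++ ys) ≤ a + b
        append xs p q = ≤-trans (≤-reflexive (length-++ xs)) (+-mono-≤ p q)

      free : AdjMat n → List (Fin n)
      free G = filter (λ x → ¬? (Any.any? (x Fin.≟_) (blocked G))) (allFin n)

      -- Toggling is an involution, so the switched graph and the pair (x , y) determine the original.
      φ : AdjMat n × Fin n → AdjMat n × Fin n × Fin n
      φ (G , x) = switch u v x (firstNbr G x) G , x , firstNbr G x

      φ-injective : ∀ {a b} → φ a ≡ φ b → a ≡ b
      φ-injective {G , x} {H , x′} e with cong (proj₁ ∘ proj₂) e | cong (proj₂ ∘ proj₂) e | cong proj₁ e
      ... | refl | e′ | e″ = cong (_, x) (toggle-injective (switched? u v x (firstNbr G x)) G H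
              (trans e″ (cong (λ y → switch u v x y H) (sym e′))))

      -- After the switching `x` is adjacent to `u` and `y` to `v`, so each graph comes with only
      -- `d * d` choices of the pair.
      target : List (AdjMat n × Fin n × Fin n)
      target = pairs (λ G → cartesianProduct (nbrs G u) (nbrs G v)) (containing E)

      φ-target : ∀ {G x} → G ∈ˡ containing ((u , v) ∷ E) → x ∈ˡ free G → φ (G , x) ∈ˡ target
      φ-target {G} {x} G∈ x∈ with ∈-filter⁻ (contains? ((u , v) ∷ E)) {xs = L} G∈
      ... | G∈L , (uv ∷ hasE) = ∈-pairs⁺
          (∈-filter⁺ (contains? E)
            (proj₂ (proj₂ enum) _ (Sw.switch-simple)
              (λ i → trans (sym (Sw.switch-degree i)) (reg i)))
            (All.tabulate keepsE))
          (∈-cartesianProduct⁺ (∈-elems⁺ (Sw.switch-ux))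
                               (∈-elems⁺ (Sw.switch-vy)))
        where
        simple : IsSimple G
        simple = proj₁ (All.lookup (proj₁ (proj₂ enum)) G∈L)
        reg : IsRegular G d
        reg = proj₂ (All.lookup (proj₁ (proj₂ enum)) G∈L)
        symm : ∀ {i j} → Adj G i j → Adj G j i
        symm = proj₂ simple _ _
        y = firstNbr G x
        xy : Adj G x y
        xy = firstNbr-adj G reg 1≤d x
        x∉ : x ∉ˡ blocked G
        x∉ = proj₂ (∈-filter⁻ (λ x → ¬? (Any.any? (x Fin.≟_) (blocked G))) {xs = allFin n} x∈)
        x≢u : x ≢ u
        x≢u e = x∉ (here e)
        ¬ux : ¬ Adj G u x
        ¬ux ux = x∉ (there (∈-++⁺ˡ (∈-elems⁺ ux)))
        y≢v : y ≢ v
        y≢v e = x∉ (there (∈-++⁺ʳ (nbrs G u) (∈-++⁺ˡ (∈-elems⁺ (symm (subst (Adj G x) e xy))))))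
        ¬vy : ¬ Adj G v y
        ¬vy vy = x∉ (there (∈-++⁺ʳ (nbrs G u) (∈-++⁺ʳ (nbrs G v) (∈-++⁺ˡ
                   (walk⇒sphere G {2} (vy ∷ symm xy ∷ []))))))
        module Sw = SwitchProperties u v x y G simple uv xy x≢u y≢v ¬ux ¬vy
        x∉E : x ∉ˡ endpoints E
        x∉E x∈E = x∉ (there (∈-++⁺ʳ (nbrs G u) (∈-++⁺ʳ (nbrs G v) (∈-++⁺ʳ (sphere G 2 v) x∈E))))
        keepsE : ∀ {e} → e ∈ˡ E → Adj (switch u v x y G) (proj₁ e) (proj₂ e)
        keepsE {a , b} e∈ = toggle-keep (switched? u v x y) G ab ¬s
          where
          ab : Adj G a b
          ab = All.lookup hasE e∈
          ¬a : a ≢ x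
          ¬a refl = x∉E (∈-concatMap e∈ (here refl))
          ¬b : b ≢ x
          ¬b refl = x∉E (∈-concatMap e∈ (there (here refl)))
          ¬s : ¬ Switched u v x y a b
          ¬s (inj₁ (inj₁ s)) = All.lookup sep e∈ s
          ¬s (inj₁ (inj₂ (inj₁ (p , _)))) = ¬a p
          ¬s (inj₁ (inj₂ (inj₂ (_ , q)))) = ¬b q
          ¬s (inj₂ (inj₁ (inj₁ (_ , q)))) = ¬b q
          ¬s (inj₂ (inj₁ (inj₂ (p , _)))) = ¬a p
          -- A pair `vy` in `E` would be an edge of `G`, which the choice of `x` excludes.
          ¬s (inj₂ (inj₂ (inj₁ (p , q)))) = ¬vy (subst₂ (Adj G) p q ab)
          ¬s (inj₂ (inj₂ (inj₂ (p , q)))) = ¬vy (subst₂ (Adj G) q p (symm ab))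

      regular : ∀ {G} F → G ∈ˡ containing F → IsRegular G d
      regular F G∈ = proj₂ (All.lookup (proj₁ (proj₂ enum)) (proj₁ (∈-filter⁻ (contains? F) {xs = L} G∈)))

      -- Double count: at least `n ∸ blockedBound` switchings leave each graph that has the extra
      -- edge, and at most `d * d` arrive at each graph containing `E`. Prescribing one more edge
      -- thus costs a factor O(1/n).
      switching : length (containing ((u , v) ∷ E)) * (n ∸ blockedBound) ≤ length (containing E) * (d * d)
      switching = begin
        length (containing ((u , v) ∷ E)) * (n ∸ blockedBound)
          ≤⟨ length-pairs≥ {f = free} _ (λ {G} G∈ → ≤-trans (∸-monoʳ-≤ n (length-blocked G (regular ((u , v) ∷ E) G∈))) (length-filter-∉ (blocked G))) ⟩
        length source
          ≡⟨ sym (length-map φ source) ⟩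
        length (map φ source)
          ≤⟨ length-mono-⊆ (Uniq.map⁺ φ-injective source-unique) into ⟩
        length target
          ≤⟨ length-pairs≤ _ (λ {G} G∈ → ≤-reflexive (trans (length-cartesianProductWith _,_ (nbrs G u) (nbrs G v))
               (cong₂ _*_ (length-nbrs G (regular E G∈) u) (length-nbrs G (regular E G∈) v)))) ⟩
        length (containing E) * (d * d) ∎
        where
        open ≤-Reasoning
        source : List (AdjMat n × Fin n)
        source = pairs free (containing ((u , v) ∷ E))
        source-unique : Unique source
        source-unique = pairs-unique (Uniq.filter⁺ (contains? ((u , v) ∷ E)) (proj₁ enum))
          (λ G → Uniq.filter⁺ _ (Uniq.allFin⁺ n))
        into : ∀ {t} → t ∈ˡ map φ source → t ∈ˡ target
        into t∈ with ∈-map⁻ φ t∈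
        ... | s , s∈ , refl = let G∈ , x∈ = ∈-pairs⁻ free (containing ((u , v) ∷ E)) s∈ in φ-target G∈ x∈

    -- One application of `switching` per prescribed edge, each costing a factor of at most
    -- `2 * (d * d)` over `n`. The cap `m` lets a single size condition on `n` serve the whole
    -- recursion.
    containing-bound : ∀ m → 2 * (1 + (d + (d + (d ^ 2 + m * 2)))) ≤ n → ∀ E → Distinct E → length E ≤ m →
      n ^ length E * length (containing E) ≤ (2 * (d * d)) ^ length E * length L
    containing-bound m n≥ [] dist le = +-monoˡ-≤ 0 (length-filter (contains? []) L)
    containing-bound m n≥ ((u , v) ∷ E) (sep ∷ dist) le = begin
      n * n ^ e * A                         ≤⟨ *-monoˡ-≤ A (*-monoˡ-≤ (n ^ e) half) ⟩
      2 * (n ∸ b) * n ^ e * A               ≡⟨ shuffle (n ∸ b) (n ^ e) A ⟩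
      2 * n ^ e * (A * (n ∸ b))             ≤⟨ *-monoʳ-≤ (2 * n ^ e) (switching u v E sep) ⟩
      2 * n ^ e * (C * (d * d))             ≡⟨ shuffle′ (n ^ e) C (d * d) ⟩
      2 * (d * d) * (n ^ e * C)             ≤⟨ *-monoʳ-≤ (2 * (d * d)) (containing-bound m n≥ E dist (≤-trans (n≤1+n _) le)) ⟩
      2 * (d * d) * ((2 * (d * d)) ^ e * length L) ≡⟨ sym (*-assoc (2 * (d * d)) ((2 * (d * d)) ^ e) (length L)) ⟩
      2 * (d * d) * (2 * (d * d)) ^ e * length L ∎
      where
      open ≤-Reasoning
      e = length E
      A = length (containing ((u , v) ∷ E))
      C = length (containing E)
      b = 1 + (d + (d + (d ^ 2 + e * 2)))
      b≤ : 2 * b ≤ n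
      b≤ = ≤-trans (*-monoʳ-≤ 2 (s≤s (+-monoʳ-≤ d (+-monoʳ-≤ d (+-monoʳ-≤ (d ^ 2) (*-monoˡ-≤ 2 (≤-trans (n≤1+n e) le))))))) n≥
      -- The blocked vertices are at most half of all, whence the factor 2 in the bound.
      half : n ≤ 2 * (n ∸ b)
      half = begin
        n              ≡⟨ sym (m+n∸m≡n n n) ⟩
        n + n ∸ n      ≤⟨ ∸-monoʳ-≤ (n + n) b≤ ⟩
        n + n ∸ 2 * b  ≡⟨ cong (λ k → n + k ∸ 2 * b) (sym (+-identityʳ n)) ⟩
        2 * n ∸ 2 * b  ≡⟨ sym (*-distribˡ-∸ 2 n b) ⟩
        2 * (n ∸ b)    ∎
      shuffle : ∀ x p a → 2 * x * p * a ≡ 2 * p * (a * x)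
      shuffle = solve-∀
      shuffle′ : ∀ p c q → 2 * p * (c * q) ≡ 2 * q * (p * c)
      shuffle′ = solve-∀

-- Tangles are rare

module _ {A : Set} where

  tuples : ℕ → List A → List (List A)
  tuples zero xs = [] ∷ []
  tuples (suc k) xs = cartesianProductWith _∷_ xs (tuples k xs)

  length-tuples : ∀ k xs → length (tuples k xs) ≡ length xs ^ k
  length-tuples zero xs = refl
  length-tuples (suc k) xs = trans (length-cartesianProductWith _∷_ xs (tuples k xs)) (cong (length xs *_) (length-tuples k xs))

  ∈-tuples⁺ : ∀ {xs l} → All (_∈ˡ xs) l → l ∈ˡ tuples (length l) xs
  ∈-tuples⁺ [] = here refl
  ∈-tuples⁺ (x∈ ∷ all) = ∈-cartesianProductWith⁺ _∷_ x∈ (∈-tuples⁺ all)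

  ∈-tuples⁻ : ∀ k xs {l} → l ∈ˡ tuples k xs → length l ≡ k
  ∈-tuples⁻ zero xs (here refl) = refl
  ∈-tuples⁻ (suc k) xs l∈ with ∈-cartesianProductWith⁻ _∷_ xs (tuples k xs) l∈
  ... | _ , _ , _ , t∈ , refl = cong suc (∈-tuples⁻ k xs t∈)

  length-filter-⊎ : {P Q R : A → Set} (P? : Decidable P) (Q? : Decidable Q) (R? : Decidable R) →
    (∀ {a} → R a → P a ⊎ Q a) → ∀ as → length (filter R? as) ≤ length (filter P? as) + length (filter Q? as)
  length-filter-⊎ P? Q? R? split [] = z≤n
  length-filter-⊎ P? Q? R? split (a ∷ as) with length-filter-⊎ P? Q? R? split as | R? a | P? a | Q? a
  ... | ih | no _  | no _  | no _  = ih
  ... | ih | no _  | no _  | yes _ = ≤-trans ih (+-monoʳ-≤ _ (n≤1+n _))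
  ... | ih | no _  | yes _ | no _  = m≤n⇒m≤1+n ih
  ... | ih | no _  | yes _ | yes _ = m≤n⇒m≤1+n (≤-trans ih (+-monoʳ-≤ _ (n≤1+n _)))
  ... | ih | yes r | no ¬p | no ¬q = ⊥-elim ([ ¬p , ¬q ] (split r))
  ... | ih | yes _ | no _  | yes _ = ≤-trans (s≤s ih) (≤-reflexive (sym (+-suc _ _)))
  ... | ih | yes _ | yes _ | no _  = s≤s ih
  ... | ih | yes _ | yes _ | yes _ = s≤s (≤-trans ih (+-monoʳ-≤ _ (n≤1+n _)))

  length-filter-mono : {P Q : A → Set} (P? : Decidable P) (Q? : Decidable Q) →
    (∀ {a} → P a → Q a) → ∀ as → length (filter P? as) ≤ length (filter Q? as)
  length-filter-mono P? Q? imp as = ≤-trans (length-filter-⊎ Q? ∅? P? (inj₁ ∘ imp) as)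
    (≤-reflexive (trans (cong (λ l → length (filter Q? as) + length l) (filter-none ∅? {as} (All.tabulate λ _ → id)))
                        (+-identityʳ _)))

  -- The factor `m` takes the place of a denominator: multiples of counts are bounded instead of
  -- probabilities.
  unionBound : {B : Set} {R : B → A → Set} (R? : ∀ b → Decidable (R b)) (m : ℕ) (c : B → ℕ) (as : List A) →
    ∀ bs → (∀ {b} → b ∈ˡ bs → m * length (filter (R? b) as) ≤ c b) →
    m * length (filter (λ a → Any.any? (λ b → R? b a) bs) as) ≤ sum (map c bs)
  unionBound R? m c as [] h = ≤-reflexive (trans (cong (λ l → m * length l)
    (filter-none (λ a → Any.any? (λ b → R? b a) []) {as} (All.tabulate λ _ ()))) (*-zeroʳ m))
  unionBound R? m c as (b ∷ bs) h = begin
    m * length (filter (any? (b ∷ bs)) as)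
      ≤⟨ *-monoʳ-≤ m (length-filter-⊎ (R? b) (any? bs) (any? (b ∷ bs)) (λ { (here r) → inj₁ r ; (there r) → inj₂ r }) as) ⟩
    m * (length (filter (R? b) as) + length (filter (any? bs) as))
      ≡⟨ *-distribˡ-+ m _ _ ⟩
    m * length (filter (R? b) as) + m * length (filter (any? bs) as)
      ≤⟨ +-mono-≤ (h (here refl)) (unionBound R? m c as bs (h ∘ there)) ⟩
    c b + sum (map c bs) ∎
    where
    open ≤-Reasoning
    any? : ∀ bs a → Dec (Any (λ b → _) bs)
    any? bs a = Any.any? (λ b → R? b a) bs

  sum-map-const : ∀ c (xs : List A) → sum (map (λ _ → c) xs) ≡ length xs * c
  sum-map-const c [] = refl
  sum-map-const c (x ∷ xs) = cong (c +_) (sum-map-const c xs)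

  sum-map-*ʳ : ∀ (f : A → ℕ) k xs → sum (map (λ x → f x * k) xs) ≡ sum (map f xs) * k
  sum-map-*ʳ f k [] = refl
  sum-map-*ʳ f k (x ∷ xs) = trans (cong (f x * k +_) (sum-map-*ʳ f k xs)) (sym (*-distribʳ-+ k (f x) (sum (map f xs))))

  sum≥ : ∀ (f : A → ℕ) xs → All (λ x → 2 ≤ f x) xs → length xs * 2 ≤ sum (map f xs)
  sum≥ f [] [] = z≤n
  sum≥ f (x ∷ xs) (p ∷ ps) = +-mono-≤ p (sum≥ f xs ps)

  sum> : ∀ (f : A → ℕ) xs → All (λ x → 2 ≤ f x) xs → Any (λ x → 3 ≤ f x) xs → length xs * 2 < sum (map f xs)
  sum> f (x ∷ xs) (p ∷ ps) (here q) = +-mono-≤ q (sum≥ f xs ps)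
  sum> f (x ∷ xs) (p ∷ ps) (there q) = ≤-trans (≤-reflexive (sym (+-suc 2 _))) (+-mono-≤ p (sum> f xs ps q))

-- Degree sums and induced edges

module _ {n : ℕ} (G : AdjMat n) (simple : IsSimple G) where

  private
    irrefl = proj₁ simple
    symm : ∀ {i j} → Adj G i j → Adj G j i
    symm = proj₂ simple _ _

  degreeIn : List (Fin n) → Fin n → ℕ
  degreeIn xs u = length (filter (adj? G u) xs)

  -- In a duplicate-free list each edge is recorded once, at the endpoint that comes first.
  inducedEdges : List (Fin n) → List Edge
  inducedEdges [] = []
  inducedEdges (x ∷ xs) = map (x ,_) (filter (adj? G x) xs) ++ inducedEdges xs

  -- Adding `x` raises by one the degree of each neighbour of `x` among `us`; by symmetry of
  -- adjacency there are `degreeIn us x` of them.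
  sum-degreeIn-∷ : ∀ x xs us → sum (map (degreeIn (x ∷ xs)) us) ≡ degreeIn us x + sum (map (degreeIn xs) us)
  sum-degreeIn-∷ x xs [] = refl
  sum-degreeIn-∷ x xs (u ∷ us) with sum-degreeIn-∷ x xs us | adj? G u x | adj? G x u
  ... | ih | yes _ | yes _ = cong suc (trans (cong (degreeIn xs u +_) ih) (shift (degreeIn xs u) (degreeIn us x) _))
    where
    shift : ∀ a b c → a + (b + c) ≡ b + (a + c)
    shift = solve-∀
  ... | ih | no _ | no _ = trans (cong (degreeIn xs u +_) ih) (shift (degreeIn xs u) (degreeIn us x) _)
    where
    shift : ∀ a b c → a + (b + c) ≡ b + (a + c)
    shift = solve-∀
  ... | ih | yes a | no ¬a = ⊥-elim (¬a (symm a))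
  ... | ih | no ¬a | yes a = ⊥-elim (¬a (symm a))

  -- A new vertex `x` contributes its degree into `xs` twice: as its own degree and as increments at
  -- its neighbours.
  handshake : ∀ xs → sum (map (degreeIn xs) xs) ≡ length (inducedEdges xs) * 2
  handshake [] = refl
  handshake (x ∷ xs) with adj? G x x
  ... | yes a = ⊥-elim (irrefl x a)
  ... | no _ = begin
    k + sum (map (degreeIn (x ∷ xs)) xs)         ≡⟨ cong (k +_) (sum-degreeIn-∷ x xs xs) ⟩
    k + (k + sum (map (degreeIn xs) xs))         ≡⟨ cong (λ t → k + (k + t)) (handshake xs) ⟩
    k + (k + length (inducedEdges xs) * 2)       ≡⟨ double k (length (inducedEdges xs)) ⟩
    (k + length (inducedEdges xs)) * 2           ≡⟨ cong (λ t → (t + length (inducedEdges xs)) * 2) (sym (length-map (x ,_) (filter (adj? G x) xs))) ⟩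
    (length (map (x ,_) (filter (adj? G x) xs)) + length (inducedEdges xs)) * 2
                                                 ≡⟨ cong (_* 2) (sym (length-++ (map (x ,_) (filter (adj? G x) xs)))) ⟩
    length (inducedEdges (x ∷ xs)) * 2           ∎
    where
    open ≡-Reasoning
    k = degreeIn xs x
    double : ∀ k e → k + (k + e * 2) ≡ (k + e) * 2
    double = solve-∀

  ∈-inducedEdges⁻ : ∀ xs {e} → e ∈ˡ inducedEdges xs → proj₁ e ∈ˡ xs × proj₂ e ∈ˡ xs × Adj G (proj₁ e) (proj₂ e)
  ∈-inducedEdges⁻ (x ∷ xs) e∈ with ∈-++⁻ (map (x ,_) (filter (adj? G x) xs)) e∈
  ... | inj₂ e∈′ = let a , b , ab = ∈-inducedEdges⁻ xs e∈′ in there a , there b , ab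
  ... | inj₁ e∈′ with ∈-map⁻ (x ,_) e∈′
  ... | y , y∈ , refl = let y∈xs , xy = ∈-filter⁻ (adj? G x) {xs = xs} y∈ in here refl , there y∈xs , xy

  inducedEdges-distinct : ∀ {xs} → Unique xs → Distinct (inducedEdges xs)
  inducedEdges-distinct [] = []
  inducedEdges-distinct {x ∷ xs} (x∉ ∷ u) = AllPairs.++⁺
    (star (Uniq.filter⁺ (adj? G x) u) (λ y∈ → proj₁ (∈-filter⁻ (adj? G x) y∈)))
    (inducedEdges-distinct u)
    (All.map⁺ (All.tabulate λ y∈ → All.tabulate λ {e} e∈ → apart (∈-inducedEdges⁻ xs e∈)))
    where
    notx : ∀ {y} → y ∈ˡ xs → y ≢ x
    notx y∈ e = All.lookup x∉ y∈ (sym e)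
    apart : ∀ {y e} → proj₁ e ∈ˡ xs × proj₂ e ∈ˡ xs × Adj G (proj₁ e) (proj₂ e) → ¬ SamePair (x , y) e
    apart (a∈ , _) (inj₁ (p , _)) = notx a∈ p
    apart (_ , b∈ , _) (inj₂ (_ , q)) = notx b∈ q
    star : ∀ {ys} → Unique ys → (∀ {y} → y ∈ˡ ys → y ∈ˡ xs) → Distinct (map (x ,_) ys)
    star [] _ = []
    star {y ∷ ys} (y∉ ∷ uy) sub = All.map⁺ (All.tabulate sep) ∷ star uy (sub ∘ there)
      where
      sep : ∀ {z} → z ∈ˡ ys → ¬ SamePair (x , y) (x , z)
      sep z∈ (inj₁ (_ , q)) = All.lookup y∉ z∈ (sym q)
      sep z∈ (inj₂ (p , _)) = notx (sub (here refl)) (sym p)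

  -- The degree at least 3 pushes the degree sum above twice the number of vertices, and `handshake`
  -- halves it.
  tangle-edges : ∀ {p} → Tangle G p → ∣ p ∣ < length (inducedEdges (elems p))
  tangle-edges {p} (min2 , u , u∈ , three) = *-cancelʳ-< 2 ∣ p ∣ _ (begin-strict
    ∣ p ∣ * 2                                     ≡⟨ cong (_* 2) (sym (length-elems p)) ⟩
    length (elems p) * 2                          <⟨ sum> (degreeIn (elems p)) (elems p)
                                                      (All.tabulate (λ x∈ → deg2 (min2 _ (∈-elems⁻ p x∈))))
                                                      (lose (∈-elems⁺ u∈) (deg3 three)) ⟩
    sum (map (degreeIn (elems p)) (elems p))      ≡⟨ handshake (elems p) ⟩
    length (inducedEdges (elems p)) * 2           ∎)
    where
    open ≤-Reasoning
    nbr : ∀ {u a} → a ∈ p × Adj G u a → a ∈ˡ filter (adj? G u) (elems p)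
    nbr {u} (a∈ , ua) = ∈-filter⁺ (adj? G u) (∈-elems⁺ a∈) ua
    deg2 : ∀ {u} → TwoNeighboursIn G p u → 2 ≤ degreeIn (elems p) u
    deg2 (a , b , a≢b , na , nb) = length-mono-⊆ {xs = a ∷ b ∷ []} ((a≢b ∷ []) ∷ [] ∷ [])
      λ { (here refl) → nbr na ; (there (here refl)) → nbr nb }
    deg3 : ∀ {u} → ThreeNeighboursIn G p u → 3 ≤ degreeIn (elems p) u
    deg3 (a , b , c , (a≢b , a≢c , b≢c) , na , nb , nc) =
      length-mono-⊆ {xs = a ∷ b ∷ c ∷ []} ((a≢b ∷ a≢c ∷ []) ∷ (b≢c ∷ []) ∷ [] ∷ [])
      λ { (here refl) → nbr na ; (there (here refl)) → nbr nb ; (there (there (here refl))) → nbr nc }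

-- Union bound over edge configurations

module _ {n : ℕ} where

  -- All lists of s + 1 pairs from s vertices: more edges than vertices, so there are only
  -- O(n ^ s) of them, while each occurs with probability O(n ^ -(s + 1)).
  configurations : ℕ → List (List (Edge {n}))
  configurations s = concatMap (λ X → tuples (suc s) (cartesianProduct X X)) (tuples s (allFin n))

  length-configurations : ∀ s → length (configurations s) ≤ n ^ s * (s * s) ^ suc s
  length-configurations s = ≤-trans
    (length-concatMap≤ (λ X → tuples (suc s) (cartesianProduct X X)) (tuples s (allFin n)) (λ {X} X∈ → ≤-reflexive (begin
      length (tuples (suc s) (cartesianProduct X X))  ≡⟨ length-tuples (suc s) (cartesianProduct X X) ⟩
      length (cartesianProduct X X) ^ suc s           ≡⟨ cong (_^ suc s) (length-cartesianProductWith _,_ X X) ⟩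
      (length X * length X) ^ suc s                   ≡⟨ cong (λ l → (l * l) ^ suc s) (∈-tuples⁻ s (allFin n) X∈) ⟩
      (s * s) ^ suc s                                 ∎)))
    (≤-reflexive (cong (_* (s * s) ^ suc s)
      (trans (length-tuples s (allFin n)) (cong (_^ s) (length-tabulate id)))))
    where open ≡-Reasoning

  -- `configurations` also produces lists with repeated pairs, to which the switching bound does not
  -- apply; distinctness is therefore part of the event.
  Occurs : ℕ → List Edge → AdjMat n → Set
  Occurs s E G = (Distinct E × length E ≡ suc s) × Contains E G

  occurs? : ∀ s E → Decidable (Occurs s E)
  occurs? s E G = (AllPairs.allPairs? (λ e f → ¬? (samePair? e f)) E ×-dec (length E ≟ suc s)) ×-dec contains? E G

  DenseOn : AdjMat n → ℕ → Set
  DenseOn G s = Any (λ E → Occurs s E G) (configurations s)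

  denseOn? : ∀ s → Decidable (λ G → DenseOn G s)
  denseOn? s G = Any.any? (λ E → occurs? s E G) (configurations s)

  tangle⇒denseOn : ∀ G → IsSimple G → ∀ {p} → Tangle G p → DenseOn G ∣ p ∣
  tangle⇒denseOn G simple {p} tangle = lose E∈ ((distinct , length≡) , All.tabulate (proj₂ ∘ proj₂ ∘ inE))
    where
    E : List Edge
    -- `tangle-edges` provides at least `suc ∣ p ∣` edges; exactly that many are kept to match
    -- `configurations`.
    E = take (suc ∣ p ∣) (inducedEdges G simple (elems p))
    length≡ : length E ≡ suc ∣ p ∣
    length≡ = trans (length-take (suc ∣ p ∣) (inducedEdges G simple (elems p))) (m≤n⇒m⊓n≡m (tangle-edges G simple tangle))
    distinct : Distinct E
    distinct = AllPairs.take⁺ (suc ∣ p ∣) (inducedEdges-distinct G simple (elems-unique p))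
    inE : ∀ {e} → e ∈ˡ E → proj₁ e ∈ˡ elems p × proj₂ e ∈ˡ elems p × Adj G (proj₁ e) (proj₂ e)
    inE e∈ = All.lookup (All.take⁺ (suc ∣ p ∣) (All.tabulate (∈-inducedEdges⁻ G simple (elems p)))) e∈
    E∈ : E ∈ˡ configurations ∣ p ∣
    E∈ = ∈-concatMap
      (subst (λ k → elems p ∈ˡ tuples k (allFin n)) (length-elems p) (∈-tuples⁺ (All.tabulate λ _ → ∈-allFin _)))
      (subst (λ k → E ∈ˡ tuples k (cartesianProduct (elems p) (elems p))) length≡
        (∈-tuples⁺ (All.tabulate λ e∈ → let a∈ , b∈ , _ = inE e∈ in ∈-cartesianProduct⁺ a∈ b∈)))

-- First factor: the edge lists per choice of `s` vertices. Second factor: the cost, from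
-- `containing-bound`, of prescribing `suc s` edges.
denseConstant : ℕ → ℕ → ℕ
denseConstant d s = (s * s) ^ suc s * (2 * (d * d)) ^ suc s

module Rarity {n d : ℕ} (1≤d : 1 ≤ d) {L : List (AdjMat n)} (enum : Enumerates n d L)
  (T : ℕ) (n-large : suc (2 * (1 + (d + (d + (d ^ 2 + suc T * 2))))) ≤ n) where

  open Switching 1≤d enum

  -- There are O(`n ^ s`) configurations, and each has probability O(1 / `n ^ suc s`); cancelling
  -- `n ^ s` leaves one factor `n`.
  dense-rare : ∀ s → s ≤ T → n * length (filter (denseOn? s) L) ≤ denseConstant d s * length L
  dense-rare s s≤T = *-cancelˡ-≤ (n ^ s) {{m^n≢0 n s {{>-nonZero (≤-trans (s≤s z≤n) n-large)}}}} (begin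
    n ^ s * (n * D)                                             ≡⟨ shuffle (n ^ s) n D ⟩
    n ^ suc s * D                                               ≤⟨ unionBound (occurs? s) (n ^ suc s) (λ _ → b) L (configurations s) (λ {E} _ → one E) ⟩
    sum (map (λ _ → b) (configurations s))                      ≡⟨ sum-map-const b (configurations s) ⟩
    length (configurations s) * b                               ≤⟨ *-monoˡ-≤ b (length-configurations s) ⟩
    n ^ s * (s * s) ^ suc s * ((2 * (d * d)) ^ suc s * length L) ≡⟨ assoc (n ^ s) ((s * s) ^ suc s) ((2 * (d * d)) ^ suc s) (length L) ⟩
    n ^ s * (denseConstant d s * length L)                      ∎)
    where
    open ≤-Reasoning
    D = length (filter (denseOn? s) L)
    b = (2 * (d * d)) ^ suc s * length L
    shuffle : ∀ p q r → p * (q * r) ≡ q * p * r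
    shuffle = solve-∀
    assoc : ∀ p q r t → p * q * (r * t) ≡ p * (q * r * t)
    assoc = solve-∀
    one : ∀ E → n ^ suc s * length (filter (occurs? s E) L) ≤ b
    one E = byCases (AllPairs.allPairs? (λ e f → ¬? (samePair? e f)) E ×-dec (length E ≟ suc s))
      where
      byCases : Dec (Distinct E × length E ≡ suc s) → n ^ suc s * length (filter (occurs? s E) L) ≤ b
      byCases (no ¬ok) = ≤-trans (≤-reflexive (trans (cong (λ l → n ^ suc s * length l)
            (filter-none (occurs? s E) {L} (All.tabulate λ _ o → ¬ok (proj₁ o)))) (*-zeroʳ (n ^ suc s)))) z≤n
      byCases (yes (dist , len)) = ≤-trans (*-monoʳ-≤ (n ^ suc s) (length-filter-mono (occurs? s E) (contains? E) proj₂ L))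
            (subst (λ k → n ^ k * length (containing E) ≤ (2 * (d * d)) ^ k * length L) len
              (containing-bound (suc T) (≤-trans (n≤1+n _) n-large) E dist (≤-trans (≤-reflexive len) (s≤s s≤T))))

  Dense : AdjMat n → Set
  Dense G = Any (DenseOn G) (upTo (suc T))

  dense? : Decidable Dense
  dense? G = Any.any? (λ s → denseOn? s G) (upTo (suc T))

  rare : n * length (filter dense? L) ≤ sum (map (denseConstant d) (upTo (suc T))) * length L
  rare = ≤-trans (unionBound denseOn? n (λ s → denseConstant d s * length L) L (upTo (suc T))
      (λ {s} s∈ → dense-rare s (s≤s⁻¹ (∈-upTo⁻ s∈))))
    (≤-reflexive (sum-map-*ʳ (denseConstant d) (length L) (upTo (suc T))))

  sparse⇒tangleFree : ∀ G → IsSimple G → ¬ Dense G → ∀ p → ∣ p ∣ ≤ T → ¬ Tangle G p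
  sparse⇒tangleFree G simple sparse p p≤ tangle = sparse (lose (∈-upTo⁺ (s≤s p≤)) (tangle⇒denseOn G simple tangle))

-- Choice of the threshold and the limit

module _ (d : ℕ) (3≤d : 3 ≤ d) (k : ℕ) (T : ℕ)
  (normalIf : ∀ {n} (G : AdjMat n) → IsSimple G → IsRegular G d → (∀ p → ∣ p ∣ ≤ T → ¬ Tangle G p) → IsNormal G) where

  private
    -- The leading `suc` keeps `C` positive for cancellation. In `N` the first summand makes the
    -- dense graphs at most a `1 / suc k` fraction, and the second meets the size condition of
    -- `Rarity`.
    C N : ℕ
    C = suc (sum (map (denseConstant d) (upTo (suc T))))
    N = suc k * C + suc (2 * (1 + (d + (d + (d ^ 2 + suc T * 2)))))

  mostlyNormal : ∀ n → N ≤ n → (L : List (AdjMat n)) → Enumerates n d L → NormalProbAtLeast n L k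
  mostlyNormal n N≤n L enum = M , Uniq.filter⁺ sparse? (proj₁ enum)
    , All.tabulate (λ G∈ → proj₁ (∈M G∈))
    , All.tabulate (λ {G} G∈ → let G∈L , sparse = ∈M G∈
                                   simple , reg = All.lookup (proj₁ (proj₂ enum)) G∈L
                               in normalIf G simple reg (sparse⇒tangleFree G simple sparse))
    -- Adding `length L` to both sides avoids subtraction and absorbs the dense graphs, of which
    -- there are at most `length L / suc k`.
    , +-cancelʳ-≤ (length L) (k * length L) (suc k * m) (begin
        k * length L + length L        ≡⟨ +-comm (k * length L) (length L) ⟩
        suc k * length L               ≤⟨ *-monoʳ-≤ (suc k) split ⟩
        suc k * (m + b)                ≡⟨ *-distribˡ-+ (suc k) m b ⟩
        suc k * m + suc k * b          ≤⟨ +-monoʳ-≤ (suc k * m) few ⟩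
        suc k * m + length L           ∎)
    where
    open ≤-Reasoning
    open Rarity {n} {d} (≤-trans (s≤s z≤n) 3≤d) enum T (≤-trans (m≤n+m _ (suc k * C)) N≤n)
    sparse? : Decidable (λ G → ¬ Dense G)
    sparse? G = ¬? (dense? G)
    M : List (AdjMat n)
    M = filter sparse? L
    m = length M
    b = length (filter dense? L)
    ∈M : ∀ {G} → G ∈ˡ M → G ∈ˡ L × ¬ Dense G
    ∈M = ∈-filter⁻ sparse? {xs = L}
    split : length L ≤ m + b
    -- Filtering by the always true `U?` presents `L` itself as a filtered list, so that the
    -- splitting bound applies.
    split = ≤-trans (≤-reflexive (cong length (sym (filter-all U? {L} (All.tabulate λ _ → tt)))))
      (length-filter-⊎ sparse? dense? U? (λ {G} _ → cases G) L)
      where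
      cases : ∀ G → ¬ Dense G ⊎ Dense G
      cases G with dense? G
      ... | yes p = inj₂ p
      ... | no ¬p = inj₁ ¬p
    few : suc k * b ≤ length L
    few = *-cancelˡ-≤ C (begin
      C * (suc k * b)      ≡⟨ shuffle C (suc k) b ⟩
      suc k * C * b        ≤⟨ *-monoˡ-≤ b (≤-trans (m≤m+n (suc k * C) _) N≤n) ⟩
      n * b                ≤⟨ rare ⟩
      pred C * length L    ≤⟨ *-monoˡ-≤ (length L) (n≤1+n (pred C)) ⟩
      C * length L         ∎)
      where
      shuffle : ∀ c k b → c * (k * b) ≡ k * c * b
      shuffle = solve-∀

  eventuallyMostlyNormal : ∃ λ N → (n : ℕ) → N ≤ n → 2 ∣ d * n →
    (L : List (AdjMat n)) → Enumerates n d L → NormalProbAtLeast n L k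
  eventuallyMostlyNormal = N , λ n N≤n _ → mostlyNormal n N≤n

theorem3 : (d : ℕ) → 3 ≤ d → (k : ℕ) → ∃ λ N → (n : ℕ) → N ≤ n → 2 ∣ d * n →
    (L : List (AdjMat n)) → Enumerates n d L → NormalProbAtLeast n L k
theorem3 d 3≤d k = eventuallyMostlyNormal d 3≤d k (tangleSize d) (λ G → tangleFree⇒normal G 3≤d)
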